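{- Let $G$ be a connected graph of order $n$ with minimum degree $\delta$, and let $trc(G)$ denote its total rainbow connection number. Then: (i) if $\delta\geq\sqrt{n-2}-1$ and $n\geq 291$, then $trc(G)\leq \frac{6n}{\delta+1}+28$; (ii) if $16\leq\delta\leq\sqrt{n-2}-2$, then $trc(G)\leq\frac{7n}{\delta+1}+32$; (iii) if $6\leq\delta\leq 15$, then $trc(G)\leq \frac{7n}{\delta+1}+4C(\delta)+12$, where $C(\delta)=e^{\frac{3\log(\delta^3+2\delta^2+3)-3(\log 3-1)}{\delta-3}}-2$.
   Context: All graphs are simple, finite and undirected; $\log$ denotes the natural logarithm. A total-colored graph is a graph in which every edge and every vertex is assigned a color. A path in a total-colored graph is a total rainbow path if its edges and its internal vertices all have pairwise distinct colors. A total-colored graph is total-rainbow connected if any two vertices are joined by a total rainbow path. For a connected graph $G$, the total rainbow connection number $trc(G)$ is the smallest number of colors in a total-coloring of $G$ that makes $G$ total-rainbow connected. -}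

module Defs where

open import Data.Nat as ℕ using (ℕ; zero; suc)
open import Data.Integer as ℤ using (ℤ; +_)
open import Data.Rational as ℚ using (ℚ; 0ℚ; 1ℚ; Positive)
open import Data.Fin using (Fin)
open import Data.Bool using (Bool; true; false; if_then_else_)
open import Data.List using (List; []; _∷_; map; allFin)
open import Data.Nat.ListAction using (sum)
open import Data.Sum using (_⊎_)
open import Data.List.Relation.Unary.Unique.Propositional using (Unique)
open import Data.Product using (Σ; ∃; _×_)
open import Relation.Binary.PropositionalEquality using (_≡_)

record Graph (n : ℕ) : Set where
  field
    adj   : Fin n → Fin n → Bool
    sym   : ∀ u v → adj u v ≡ adj v u
    irrefl : ∀ v → adj v v ≡ false
open Graph public

module _ {n : ℕ} (G : Graph n) where

  degree : Fin n → ℕ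
  degree v = sum (map (λ u → if adj G v u then 1 else 0) (allFin n))

  IsMinDegree : ℕ → Set
  IsMinDegree δ = (∀ v → δ ℕ.≤ degree v) × ∃ λ v → degree v ≡ δ

  data Walk : Fin n → Fin n → Set where
    []   : ∀ {v} → Walk v v
    step : ∀ {u w v} → adj G u w ≡ true → Walk w v → Walk u v

  vertices : ∀ {u v} → Walk u v → List (Fin n)
  vertices {u} []         = u ∷ []
  vertices {u} (step _ p) = u ∷ vertices p

  IsPath : ∀ {u v} → Walk u v → Set
  IsPath p = Unique (vertices p)

  Connected : Set
  Connected = ∀ u v → Walk u v

  record TotalColoring (k : ℕ) : Set where
    field
      vcol : Fin n → Fin k
      ecol : Fin n → Fin n → Fin k
      ecol-sym : ∀ u v → ecol u v ≡ ecol v u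
  open TotalColoring public

  totalColors : ∀ {k} → TotalColoring k → ∀ {u v} → Walk u v → List (Fin k)
  totalColors c [] = []
  totalColors c (step {u} {w} _ []) = ecol c u w ∷ []
  totalColors c (step {u} {w} _ (step e p)) =
    ecol c u w ∷ vcol c w ∷ totalColors c (step e p)

  IsTotalRainbowPath : ∀ {k} → TotalColoring k → ∀ {u v} → Walk u v → Set
  IsTotalRainbowPath c p = IsPath p × Unique (totalColors c p)

  TotalRainbowConnected : ∀ {k} → TotalColoring k → Set
  TotalRainbowConnected c = ∀ u v → Σ (Walk u v) (IsTotalRainbowPath c)

  TRCColorable : ℕ → Set
  TRCColorable k = Σ (TotalColoring k) TotalRainbowConnected

  IsTRC : ℕ → Set
  IsTRC t = TRCColorable t × (∀ k → TRCColorable k → t ℕ.≤ k)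

expTerm : ℚ → ℕ → ℚ
expTerm x zero    = 1ℚ
expTerm x (suc k) = expTerm x k ℚ.* x ℚ.* ((+ 1) ℚ./ suc k)

expPartial : ℚ → ℕ → ℚ
expPartial x zero    = 0ℚ
expPartial x (suc N) = expPartial x N ℚ.+ expTerm x N

-- r ≤ c · e^x  (for c, x ≥ 0), with e^x = sup_N Σ_{k<N} x^k/k!
LeScaledExp : ℚ → ℚ → ℚ → Set
LeScaledExp r c x = ∀ (ε : ℚ) → Positive ε → ∃ λ N → r ℚ.≤ c ℚ.* expPartial x N ℚ.+ ε

powℚ : ℚ → ℕ → ℚ
powℚ q zero    = 1ℚ
powℚ q (suc m) = powℚ q m ℚ.* q

Aδ : ℕ → ℕ
Aδ δ = δ ℕ.* δ ℕ.* δ ℕ.+ 2 ℕ.* δ ℕ.* δ ℕ.+ 3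

-- "t ≤ 7n/(δ+1) + 4 C(δ) + 12" for 6 ≤ δ, where
-- C(δ) = exp((3 log A - 3(log 3 - 1))/(δ-3)) - 2 = (A e / 3)^(3/(δ-3)) - 2.
-- With q = ((t-4)(δ+1) - 7n) / (4(δ+1)) this says q ≤ (A e/3)^(3/(δ-3)),
-- i.e. q ≤ 0 or q^(δ-3) ≤ (A/3)^3 · e^3.
BoundIII : ℕ → ℕ → ℕ → Set
BoundIII n δ t =
  (q ℚ.≤ 0ℚ) ⊎ LeScaledExp (powℚ q (δ ℕ.∸ 3)) (powℚ ((+ Aδ δ) ℚ./ 3) 3) ((+ 3) ℚ./ 1)
  where
    q : ℚ
    q = (((+ t) ℤ.- (+ 4)) ℤ.* (+ suc δ) ℤ.- (+ (7 ℕ.* n))) ℚ./ (4 ℕ.* suc δ)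

{-# OPTIONS --safe #-}
module Submission where

open import Defs hiding (sym)
open import Data.Bool using (Bool; true; false; not; _∨_; if_then_else_)
import Data.Bool.Properties as Bool
open import Data.Empty using (⊥; ⊥-elim)
open import Data.Fin using (Fin; zero; suc; toℕ; join; combine; splitAt)
open import Data.Fin.Patterns
open import Data.Fin.Properties using (_≟_; any?; <-cmp; _<?_; toℕ<n; combine-injective; splitAt-join; toℕ-injective)
import Data.Integer as ℤ
import Data.Integer.Properties as ℤ
import Data.Integer.Tactic.RingSolver as ℤRing
open import Data.List using (List; []; _∷_; _++_; length; map; filter; allFin; lookup)
open import Data.List.Membership.DecPropositional using (_∈?_)
open import Data.List.Membership.Propositional as Membership using (_∈_; _∉_)
open import Data.List.Membership.Propositional.Properties
  using (∈-filter⁺; ∈-filter⁻; ∈-∃++; ∈-allFin; ∈-length; ∈-map⁻; ∈-map⁺; ∈-lookup)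
open import Data.List.Properties using (filter-notAll; filter-none; length-filter; length-tabulate)
open import Data.List.Relation.Binary.Permutation.Propositional using (_↭_; ↭⇒↭ₛ)
open import Data.List.Relation.Binary.Permutation.Propositional.Properties using (shift; ↭-length; All-resp-↭)
import Data.List.Relation.Binary.Permutation.Setoid.Properties as Permutationₛ
open import Data.List.Relation.Unary.All as All using (All; []; _∷_)
import Data.List.Relation.Unary.All.Properties as Allₚ
open import Data.List.Relation.Unary.AllPairs using ([]; _∷_)
open import Data.List.Relation.Unary.Any as Any using (Any; here; there; index)
open import Data.List.Relation.Unary.Any.Properties using (lookup-index)
open import Data.List.Relation.Unary.Unique.Propositional using (Unique)
import Data.List.Relation.Unary.Unique.Propositional.Properties as Uniqueₚ
open import Data.Nat using (ℕ; zero; suc; _+_; _*_; _∸_; _/_; _^_; _≤_; _<_; _≤?_; z≤n; s≤s)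
open import Data.Nat.DivMod using (m<n*o⇒m/o<n; m*n/n≡m; /-monoˡ-≤)
open import Data.Nat.ListAction using (sum)
open import Data.Nat.Properties hiding (_≟_; <-cmp; _<?_; suc-injective)
open import Data.Nat.Tactic.RingSolver using (solve-∀)
open import Data.Product using (Σ; ∃; _×_; _,_; proj₁; proj₂)
open import Data.Product.Properties using (≡-dec)
open import Data.Rational as ℚ using (ℚ; 0ℚ; 1ℚ)
import Data.Rational.Properties as ℚ
import Data.Rational.Unnormalised as ℚᵘ
import Data.Rational.Unnormalised.Properties as ℚᵘ
open import Data.Sum using (_⊎_; inj₁; inj₂)
open import Data.Sum.Properties using (inj₁-injective; inj₂-injective)
open import Data.Unit using (⊤; tt)
open import Data.Vec as Vec using (Vec; []; _∷_; _[_]≔_)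
open import Data.Vec.Properties using (lookup∘update′)
open import Function using (_∘_; id)
open import Relation.Binary using (tri<; tri≈; tri>)
open import Relation.Binary.PropositionalEquality
open import Relation.Nullary using (¬_; Dec; yes; no; does; contradiction)
open import Relation.Nullary.Decidable using (_→-dec_; _×-dec_; _⊎-dec_; ¬?; map′; decidable-stable; toWitness)
open import Relation.Unary using (Decidable)

-- For δ ≥ 2 the three bounds follow from t (δ + 1) ≤ 6 n + 24 (δ + 1).
--
-- Grow a tree L greedily, keeping |L| (δ + 1) ≤ 3 |N[L]|.  One may add: a vertex at distance 3
-- together with the path to it; a vertex x at distance 2 together with one neighbour, if x has few
-- neighbours at distance 1; a vertex at distance 1, if it has many neighbours at distance 2.  When
-- nothing can be added, every vertex is within distance 2 of L, and for r = ⌊δ / 3⌋ every vertex at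
-- distance 2 has more than r neighbours at distance 1, while every vertex at distance 1 has at
-- most r neighbours at distance 2.
--
-- The neighbourhoods of the vertices at distance 2 thus form a hypergraph with edges of size > r and
-- degrees ≤ r.  Rosenfeld's counting argument gives it a 4-coloring τ without monochromatic edges:
-- each time a vertex is added, at least half of the colorings stay proper.
--
-- The tree gets 2 |L| private colors, and 24 further colors, determined by τ and by a labelling
-- σ that gives each vertex at distance 1 a neighbour at distance 1 with the other label, if it has
-- any neighbour there at all, provide any two vertices with color-disjoint routes to L.

-- Rosenfeld counting for hypergraph colorings

-- The Iverson bracket; it turns counts of colorings into values of `∑`.
⟦_⟧ : ∀ {a} {A : Set a} → Dec A → ℕ
⟦ d ⟧ = if does d then 1 else 0

⟦⟧-mono : ∀ {a b} {A : Set a} {B : Set b} (d : Dec A) (e : Dec B) → (A → B) → ⟦ d ⟧ ≤ ⟦ e ⟧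
⟦⟧-mono (no _)  _       _ = z≤n
⟦⟧-mono (yes _) (yes _) _ = s≤s z≤n
⟦⟧-mono (yes a) (no ¬b) f = contradiction (f a) ¬b

⟦⟧-cong : ∀ {a b} {A : Set a} {B : Set b} (d : Dec A) (e : Dec B) →
          (A → B) → (B → A) → ⟦ d ⟧ ≡ ⟦ e ⟧
⟦⟧-cong d e f g = ≤-antisym (⟦⟧-mono d e f) (⟦⟧-mono e d g)

⟦⟧-× : ∀ {a b} {A : Set a} {B : Set b} (d : Dec A) (e : Dec B) → ⟦ d ×-dec e ⟧ ≡ ⟦ e ⟧ * ⟦ d ⟧
⟦⟧-× (no _)  e = sym (*-zeroʳ ⟦ e ⟧)
⟦⟧-× (yes _) e = sym (*-identityʳ ⟦ e ⟧)

⟦⟧-cover : ∀ {a b} {A : Set a} {B : Set b} (d : Dec A) (e : Dec B) {k : ℕ} →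
           (A → ¬ B → 0 < k) → ⟦ d ⟧ ≤ ⟦ e ⟧ + k
⟦⟧-cover (no _)  _       _ = z≤n
⟦⟧-cover (yes _) (yes _) _ = s≤s z≤n
⟦⟧-cover (yes a) (no ¬b) h = h a ¬b

FourColoring : ℕ → Set
FourColoring n = Vec (Fin 4) n

sumFirst : ∀ {n} → (FourColoring (suc n) → ℕ) → FourColoring n → ℕ
sumFirst F f = F (0F ∷ f) + (F (1F ∷ f) + (F (2F ∷ f) + F (3F ∷ f)))

∑ : ∀ {n} → (FourColoring n → ℕ) → ℕ
∑ {zero}  F = F []
∑ {suc n} F = ∑ (sumFirst F)

∑-mono : ∀ {n} {F G : FourColoring n → ℕ} → (∀ f → F f ≤ G f) → ∑ F ≤ ∑ G
∑-mono {zero}  h = h []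
∑-mono {suc n} h = ∑-mono λ f →
  +-mono-≤ (h (0F ∷ f)) (+-mono-≤ (h (1F ∷ f)) (+-mono-≤ (h (2F ∷ f)) (h (3F ∷ f))))

∑-cong : ∀ {n} {F G : FourColoring n → ℕ} → (∀ f → F f ≡ G f) → ∑ F ≡ ∑ G
∑-cong h = ≤-antisym (∑-mono (≤-reflexive ∘ h)) (∑-mono (≤-reflexive ∘ sym ∘ h))

∑-+ : ∀ {n} (F G : FourColoring n → ℕ) → ∑ (λ f → F f + G f) ≡ ∑ F + ∑ G
∑-+ {zero}  F G = refl
∑-+ {suc n} F G = trans
  (∑-cong λ f → interchange (F (0F ∷ f)) (F (1F ∷ f)) (F (2F ∷ f)) _ _ _ _ _)
  (∑-+ (sumFirst F) (sumFirst G))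
  where
  interchange : ∀ a b c d a′ b′ c′ d′ →
    (a + a′) + ((b + b′) + ((c + c′) + (d + d′))) ≡ (a + (b + (c + d))) + (a′ + (b′ + (c′ + d′)))
  interchange = solve-∀

∑-0 : ∀ n → ∑ {n} (λ _ → 0) ≡ 0
∑-0 zero    = refl
∑-0 (suc n) = ∑-0 n

∑-suc : ∀ {n} (F : FourColoring (suc n) → ℕ) →
        ∑ F ≡ ∑ (F ∘ (0F ∷_)) + (∑ (F ∘ (1F ∷_)) + (∑ (F ∘ (2F ∷_)) + ∑ (F ∘ (3F ∷_))))
∑-suc {n} F = trans (∑-+ (at 0F) (λ f → F (1F ∷ f) + (F (2F ∷ f) + F (3F ∷ f))))
  (cong (∑ (at 0F) +_) (trans (∑-+ (at 1F) (λ f → F (2F ∷ f) + F (3F ∷ f)))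
    (cong (∑ (at 1F) +_) (∑-+ (at 2F) (at 3F)))))
  where
  at : Fin 4 → FourColoring n → ℕ
  at c = F ∘ (c ∷_)

Independent : ∀ {n} {A : Set} → Fin n → (FourColoring n → A) → Set
Independent u W = ∀ f c → W (f [ u ]≔ c) ≡ W f

-- Group the colorings into classes of four that differ only at `u`. On a class `W` and `g` are
-- constant, so exactly one member satisfies the equation.
∑-fix : ∀ {n} (u : Fin n) (W : FourColoring n → ℕ) (g : FourColoring n → Fin 4) →
        Independent u W → Independent u g →
        4 * ∑ (λ f → W f * ⟦ Vec.lookup f u ≟ g f ⟧) ≡ ∑ W
∑-fix {suc n} zero W g W-ind g-ind = begin
  4 * ∑ (λ f → W f * ⟦ Vec.lookup f zero ≟ g f ⟧) ≡⟨ cong (4 *_) (∑-cong pointwise) ⟩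
  4 * ∑ (λ f → W (0F ∷ f))                     ≡⟨ four (∑ (λ f → W (0F ∷ f))) ⟩
  S + (S + (S + S))                            ≡⟨ cong (S +_) (cong₂ _+_ (const-in 1F) (cong₂ _+_ (const-in 2F) (const-in 3F))) ⟩
  _                                            ≡⟨ ∑-suc W ⟨
  ∑ W ∎
  where
  open ≡-Reasoning
  S : ℕ
  S = ∑ (λ f → W (0F ∷ f))
  four : ∀ a → 4 * a ≡ a + (a + (a + a))
  four = solve-∀
  const-in : ∀ c → S ≡ ∑ (λ f → W (c ∷ f))
  const-in c = ∑-cong λ f → sym (W-ind (0F ∷ f) c)
  H : Fin 4 → FourColoring n → ℕ
  H i f = W (i ∷ f) * ⟦ i ≟ g (i ∷ f) ⟧
  pointwise : ∀ f → H 0F f + (H 1F f + (H 2F f + H 3F f)) ≡ W (0F ∷ f)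
  pointwise f
    rewrite W-ind (0F ∷ f) 1F | W-ind (0F ∷ f) 2F | W-ind (0F ∷ f) 3F
          | g-ind (0F ∷ f) 1F | g-ind (0F ∷ f) 2F | g-ind (0F ∷ f) 3F
    with W (0F ∷ f) | g (0F ∷ f)
  ... | w | 0F = lem w where
    lem : ∀ w → w * 1 + (w * 0 + (w * 0 + w * 0)) ≡ w
    lem = solve-∀
  ... | w | 1F = lem w where
    lem : ∀ w → w * 0 + (w * 1 + (w * 0 + w * 0)) ≡ w
    lem = solve-∀
  ... | w | 2F = lem w where
    lem : ∀ w → w * 0 + (w * 0 + (w * 1 + w * 0)) ≡ w
    lem = solve-∀
  ... | w | 3F = lem w where
    lem : ∀ w → w * 0 + (w * 0 + (w * 0 + w * 1)) ≡ w
    lem = solve-∀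
∑-fix {suc n} (suc u) W g W-ind g-ind = begin
  4 * ∑ H                          ≡⟨ cong (4 *_) (∑-suc H) ⟩
  4 * (Σ₀ + (Σ₁ + (Σ₂ + Σ₃)))      ≡⟨ distrib Σ₀ Σ₁ Σ₂ Σ₃ ⟩
  4 * Σ₀ + (4 * Σ₁ + (4 * Σ₂ + 4 * Σ₃))
    ≡⟨ cong₂ _+_ (ih 0F) (cong₂ _+_ (ih 1F) (cong₂ _+_ (ih 2F) (ih 3F))) ⟩
  _                                ≡⟨ ∑-suc W ⟨
  ∑ W ∎
  where
  open ≡-Reasoning
  H : FourColoring (suc n) → ℕ
  H f = W f * ⟦ Vec.lookup f (suc u) ≟ g f ⟧
  Σ₀ Σ₁ Σ₂ Σ₃ : ℕ
  Σ₀ = ∑ (H ∘ (0F ∷_))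
  Σ₁ = ∑ (H ∘ (1F ∷_))
  Σ₂ = ∑ (H ∘ (2F ∷_))
  Σ₃ = ∑ (H ∘ (3F ∷_))
  distrib : ∀ a b c d → 4 * (a + (b + (c + d))) ≡ 4 * a + (4 * b + (4 * c + 4 * d))
  distrib = solve-∀
  ih : ∀ i → 4 * ∑ (H ∘ (i ∷_)) ≡ ∑ (W ∘ (i ∷_))
  ih i = ∑-fix u (W ∘ (i ∷_)) (g ∘ (i ∷_)) (λ f → W-ind (i ∷ f)) (λ f → g-ind (i ∷ f))

agree? : ∀ {n} (v : Fin n) (us : List (Fin n)) (f : FourColoring n) →
         Dec (All (λ u → Vec.lookup f u ≡ Vec.lookup f v) us)
agree? v us f = All.all? (λ u → Vec.lookup f u ≟ Vec.lookup f v) us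

-- One use of `∑-fix` per element of `us`: the prescribed color is that of `v`, which does not
-- change with the color of `u` because `v ∉ us`.
∑-agree : ∀ {n} (v : Fin n) (us : List (Fin n)) (W : FourColoring n → ℕ) →
          Unique us → v ∉ us → All (λ u → Independent u W) us →
          4 ^ length us * ∑ (λ f → W f * ⟦ agree? v us f ⟧) ≡ ∑ W
∑-agree v [] W _ _ _ = trans (*-identityˡ _) (∑-cong λ f → *-identityʳ (W f))
∑-agree v (u ∷ us) W (u∉us ∷ uniq) v∉ (indep ∷ indeps) = begin
  4 * 4 ^ length us * ∑ (λ f → W f * ⟦ agree? v (u ∷ us) f ⟧)
    ≡⟨ cong (4 * 4 ^ length us *_) (∑-cong λ f → split f) ⟩
  4 * 4 ^ length us * ∑ (λ f → W′ f * ⟦ Vec.lookup f u ≟ Vec.lookup f v ⟧)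
    ≡⟨ swap 4 (4 ^ length us) _ ⟩
  4 ^ length us * (4 * ∑ (λ f → W′ f * ⟦ Vec.lookup f u ≟ Vec.lookup f v ⟧))
    ≡⟨ cong (4 ^ length us *_) (∑-fix u W′ (λ f → Vec.lookup f v) W′-ind v-ind) ⟩
  4 ^ length us * ∑ W′
    ≡⟨ ∑-agree v us W uniq (v∉ ∘ there) indeps ⟩
  ∑ W ∎
  where
  open ≡-Reasoning
  W′ : FourColoring _ → ℕ
  W′ f = W f * ⟦ agree? v us f ⟧
  swap : ∀ a b c → a * b * c ≡ b * (a * c)
  swap = solve-∀
  split : ∀ f → W f * ⟦ agree? v (u ∷ us) f ⟧ ≡ W′ f * ⟦ Vec.lookup f u ≟ Vec.lookup f v ⟧
  split f = trans (cong (W f *_) (trans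
      (⟦⟧-cong (agree? v (u ∷ us) f) ((Vec.lookup f u ≟ Vec.lookup f v) ×-dec agree? v us f)
        (λ { (p ∷ ps) → p , ps }) (λ { (p , ps) → p ∷ ps }))
      (⟦⟧-× (Vec.lookup f u ≟ Vec.lookup f v) (agree? v us f))))
    (sym (*-assoc (W f) _ _))
  v-ind : Independent u (λ f → Vec.lookup f v)
  v-ind f c = lookup∘update′ (λ eq → v∉ (here eq)) f c
  others : ∀ f c {w} → w ∈ us → Vec.lookup (f [ u ]≔ c) w ≡ Vec.lookup f w
  others f c w∈ = lookup∘update′ (λ eq → All.lookup u∉us w∈ (sym eq)) f c
  W′-ind : Independent u W′
  W′-ind f c = cong₂ _*_ (indep f c) (⟦⟧-cong (agree? v us (f [ u ]≔ c)) (agree? v us f)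
    (λ ps → All.tabulate λ w∈ → trans (sym (others f c w∈)) (trans (All.lookup ps w∈) (v-ind f c)))
    (λ ps → All.tabulate λ w∈ → trans (others f c w∈) (trans (All.lookup ps w∈) (sym (v-ind f c)))))

Mono : ∀ {n} → FourColoring n → List (Fin n) → Set
Mono f e = ∃ λ c → All (λ u → Vec.lookup f u ≡ c) e

mono? : ∀ {n} (f : FourColoring n) (e : List (Fin n)) → Dec (Mono f e)
mono? f e = any? λ c → All.all? (λ u → Vec.lookup f u ≟ c) e

∑-positive⁻ : ∀ {n} (F : FourColoring n → ℕ) → 0 < ∑ F → ∃ λ f → 0 < F f
∑-positive⁻ {zero}  F 0<∑ = [] , 0<∑
∑-positive⁻ {suc n} F 0<∑ with ∑-positive⁻ (sumFirst F) 0<∑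
... | f , 0<s with F (0F ∷ f) in e₀ | F (1F ∷ f) in e₁ | F (2F ∷ f) in e₂ | F (3F ∷ f) in e₃
... | suc _ | _     | _     | _     = 0F ∷ f , subst (0 <_) (sym e₀) (s≤s z≤n)
... | zero  | suc _ | _     | _     = 1F ∷ f , subst (0 <_) (sym e₁) (s≤s z≤n)
... | zero  | zero  | suc _ | _     = 2F ∷ f , subst (0 <_) (sym e₂) (s≤s z≤n)
... | zero  | zero  | zero  | suc _ = 3F ∷ f , subst (0 <_) (sym e₃) (s≤s z≤n)

⟦⟧-positive : ∀ {a} {A : Set a} (d : Dec A) → A → 0 < ⟦ d ⟧
⟦⟧-positive (yes _) _ = s≤s z≤n
⟦⟧-positive (no ¬a) a = contradiction a ¬a

⟦⟧-positive⁻ : ∀ {a} {A : Set a} (d : Dec A) → 0 < ⟦ d ⟧ → A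
⟦⟧-positive⁻ (yes a) _ = a

∑-positive : ∀ {n} (F : FourColoring n → ℕ) → (∀ f → 0 < F f) → 0 < ∑ F
∑-positive {zero}  F h = h []
∑-positive {suc n} F h = ∑-positive (sumFirst F) λ f → ≤-trans (h (0F ∷ f)) (m≤m+n _ _)

-- The numerical heart of the halving argument: `r` bad events, each of weight at most 2 to the
-- power -r, cover at most half of the colorings.
2*m≤2^m : ∀ m → 2 * m ≤ 2 ^ m
2*m≤2^m zero    = z≤n
2*m≤2^m (suc m) = *-monoʳ-≤ 2 (n<2^n m)
  where
  n<2^n : ∀ m → m < 2 ^ m
  n<2^n zero    = s≤s z≤n
  n<2^n (suc m) = +-mono-≤ {1} (m^n>0 2 m) (≤-trans (n<2^n m) (m≤m+n _ 0))

-- Hypergraphs whose edge sizes exceed `r` and whose degrees are at most `r`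

module Hypergraph {n : ℕ} (Es : List (List (Fin n))) (r : ℕ)
  (E-unique : All Unique Es) (E-large : All (λ e → r < length e) Es)
  (sparse : ∀ v → length (filter (_∈?_ _≟_ v) Es) ≤ r)
  where

  In : List (Fin n) → List (Fin n) → Set
  In X e = All (_∈ X) e

  in? : ∀ X e → Dec (In X e)
  in? X e = All.all? (λ u → _∈?_ _≟_ u X) e

  -- Only edges inside `X` are constrained, yet all `n` vertices are colored. Every count thus
  -- ranges over the same colorings, and `M` is antitone in `X`.
  Proper : List (Fin n) → FourColoring n → Set
  Proper X f = All (λ e → In X e → ¬ Mono f e) Es

  proper? : ∀ X f → Dec (Proper X f)
  proper? X f = All.all? (λ e → in? X e →-dec ¬? (mono? f e)) Es

  M : List (Fin n) → ℕ
  M X = ∑ λ f → ⟦ proper? X f ⟧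

  Proper-anti : ∀ {X Y f} → (∀ {u} → u ∈ X → u ∈ Y) → Proper Y f → Proper X f
  Proper-anti X⊆Y = All.map λ good inX → good (All.map X⊆Y inX)

  M-anti : ∀ {X Y} → (∀ {u} → u ∈ X → u ∈ Y) → M Y ≤ M X
  M-anti {X} {Y} X⊆Y = ∑-mono λ f → ⟦⟧-mono (proper? Y f) (proper? X f) (Proper-anti {f = f} X⊆Y)

  _∖_ : List (Fin n) → List (Fin n) → List (Fin n)
  X ∖ []       = X
  X ∖ (u ∷ us) = filter (λ w → ¬? (w ≟ u)) X ∖ us

  ∖-⊆ : ∀ X us {w} → w ∈ X ∖ us → w ∈ X
  ∖-⊆ X []       w∈ = w∈
  ∖-⊆ X (u ∷ us) w∈ = proj₁ (∈-filter⁻ (λ w → ¬? (w ≟ u)) (∖-⊆ (filter _ X) us w∈))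

  ∖-disjoint : ∀ X us {w} → w ∈ us → w ∉ X ∖ us
  ∖-disjoint X (u ∷ us) (here refl) w∈ =
    proj₂ (∈-filter⁻ (λ w → ¬? (w ≟ u)) {xs = X} (∖-⊆ (filter _ X) us w∈)) refl
  ∖-disjoint X (u ∷ us) (there p) w∈ = ∖-disjoint (filter _ X) us p w∈

  Proper-update : ∀ {X u} → u ∉ X → ∀ f c → Proper X f → Proper X (f [ u ]≔ c)
  Proper-update {X} {u} u∉X f c = All.map λ good inX (i , all) → good inX (i , All.tabulate λ {w} w∈ →
    trans (sym (lookup∘update′ {i = w} {u} (λ { refl → u∉X (All.lookup inX w∈) }) f c)) (All.lookup all w∈))

  Proper-update⁻ : ∀ {X u} → u ∉ X → ∀ f c → Proper X (f [ u ]≔ c) → Proper X f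
  Proper-update⁻ {X} {u} u∉X f c = All.map λ good inX (i , all) → good inX (i , All.tabulate λ {w} w∈ →
    trans (lookup∘update′ {i = w} {u} (λ { refl → u∉X (All.lookup inX w∈) }) f c) (All.lookup all w∈))

  proper-independent : ∀ {X u} → u ∉ X → Independent u (λ f → ⟦ proper? X f ⟧)
  proper-independent {X} {u} u∉X f c =
    ⟦⟧-cong (proper? X (f [ u ]≔ c)) (proper? X f) (Proper-update⁻ u∉X f c) (Proper-update u∉X f c)

  -- Rosenfeld's invariant. As colors outside `X` are free, for a new vertex `v` it says that the
  -- proper colorings of `X` alone at least double in number when `v` joins: of the factor 4, a
  -- factor 2 survives.
  Halving : List (Fin n) → Set
  Halving X = ∀ v → M X ≤ 2 * M (v ∷ X)

  -- Vertices are removed one at a time. Removing some `u ∈ X` leaves a shorter list, so `Halving`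
  -- applies to putting `u` back; removing `u ∉ X` costs nothing.
  M-∖ : ∀ X us → (∀ Y → length Y < length X → Halving Y) → M (X ∖ us) ≤ 2 ^ length us * M X
  M-∖ X []       ih = ≤-reflexive (sym (*-identityˡ (M X)))
  M-∖ X (u ∷ us) ih = begin
    M (X′ ∖ us)                  ≤⟨ M-∖ X′ us (λ Y Y< → ih Y (<-≤-trans Y< X′≤X)) ⟩
    2 ^ length us * M X′         ≤⟨ *-monoʳ-≤ (2 ^ length us) one ⟩
    2 ^ length us * (2 * M X)    ≡⟨ swap (2 ^ length us) 2 (M X) ⟩
    2 ^ length (u ∷ us) * M X    ∎
    where
    open ≤-Reasoning
    X′ : List (Fin n)
    X′ = filter (λ w → ¬? (w ≟ u)) X
    X′≤X : length X′ ≤ length X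
    X′≤X = length-filter (λ w → ¬? (w ≟ u)) X
    swap : ∀ a b c → a * (b * c) ≡ b * a * c
    swap = solve-∀
    X⊆ : ∀ {w} → w ∈ X → w ∈ u ∷ X′
    X⊆ {w} w∈ with w ≟ u
    ... | yes eq = here eq
    ... | no neq = there (∈-filter⁺ (λ w → ¬? (w ≟ u)) w∈ neq)
    one : M X′ ≤ 2 * M X
    one with _∈?_ _≟_ u X
    ... | no u∉X = ≤-trans (M-anti λ {w} w∈ → ∈-filter⁺ (λ w → ¬? (w ≟ u)) w∈ λ { refl → u∉X w∈ }) (m≤m+n (M X) _)
    ... | yes u∈X = ≤-trans
      (ih X′ (filter-notAll (λ w → ¬? (w ≟ u)) X (Any.map (λ { refl ¬eq → ¬eq refl }) u∈X)) u)
      (*-monoʳ-≤ 2 (M-anti {X} {u ∷ X′} X⊆))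

  -- With us = e minus v and p = |us|: being proper on X ∖ us does not depend on the colors of us, so
  -- monochromaticity of e costs a factor 4 ^ p, while putting us back loses at most a factor 2 ^ p.
  bad-bound : ∀ X v e → v ∉ X → v ∈ e → Unique e → r < length e →
              (∀ Y → length Y < length X → Halving Y) →
              2 ^ r * ∑ (λ f → ⟦ proper? X f ⟧ * ⟦ mono? f e ⟧) ≤ M X
  bad-bound X v e v∉X v∈e e-unique r<e ih with as , bs , refl ← ∈-∃++ v∈e = *-cancelˡ-≤ (2 ^ p) (begin
    2 ^ p * (2 ^ r * B)                  ≤⟨ *-monoʳ-≤ (2 ^ p) (*-monoˡ-≤ B (^-monoʳ-≤ 2 r≤p)) ⟩
    2 ^ p * (2 ^ p * B)                  ≡⟨ square p B ⟩
    4 ^ p * B                            ≤⟨ *-monoʳ-≤ (4 ^ p) (∑-mono λ f → *-mono-≤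
                                              (⟦⟧-mono (proper? X f) (proper? (X ∖ us) f) (Proper-anti {f = f} (∖-⊆ X us)))
                                              (⟦⟧-mono (mono? f _) (agree? v us f) (mono⇒agree f))) ⟩
    4 ^ p * ∑ (λ f → ⟦ proper? (X ∖ us) f ⟧ * ⟦ agree? v us f ⟧)
                                         ≡⟨ ∑-agree v us (λ f → ⟦ proper? (X ∖ us) f ⟧) us-unique v∉us
                                              (All.tabulate λ w∈ → proper-independent (∖-disjoint X us w∈)) ⟩
    M (X ∖ us)                           ≤⟨ M-∖ X us ih ⟩
    2 ^ p * M X                          ∎)
    where
    open ≤-Reasoning
    us : List (Fin n)
    us = as ++ bs
    p : ℕ
    p = length us
    instance _ = m^n≢0 2 p
    B : ℕ
    B = ∑ (λ f → ⟦ proper? X f ⟧ * ⟦ mono? f (as ++ v ∷ bs) ⟧)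
    e↭ : as ++ v ∷ bs ↭ v ∷ us
    e↭ = shift v as bs
    v∷us-unique : Unique (v ∷ us)
    v∷us-unique = Permutationₛ.Unique-resp-↭ (setoid (Fin n)) (↭⇒↭ₛ e↭) e-unique
    us-unique : Unique us
    us-unique with _ ∷ u ← v∷us-unique = u
    v∉us : v ∉ us
    v∉us v∈ with d ∷ _ ← v∷us-unique = All.lookup d v∈ refl
    r≤p : r ≤ p
    r≤p = ≤-pred (subst (r <_) (↭-length e↭) r<e)
    mono⇒agree : ∀ f → Mono f (as ++ v ∷ bs) → All (λ u → Vec.lookup f u ≡ Vec.lookup f v) us
    mono⇒agree f (c , all) with fv ∷ rest ← All-resp-↭ e↭ all = All.map (λ eq → trans eq (sym fv)) rest
    square : ∀ p B → 2 ^ p * (2 ^ p * B) ≡ 4 ^ p * B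
    square zero    B = *-identityˡ (1 * B)
    square (suc p) B = trans (lem (2 ^ p) B) (trans (cong (4 *_) (square p B)) (sym (*-assoc 4 (4 ^ p) B)))
      where
      lem : ∀ x B → 2 * x * (2 * x * B) ≡ 4 * (x * (x * B))
      lem = solve-∀

  -- A coloring that is proper on `X` but not on `v ∷ X` has a monochromatic edge through `v`. There
  -- are at most `r` such edges, and by `bad-bound` each spoils at most `M X` over `2 ^ r`
  -- colorings.
  halving-step : ∀ X → (∀ Y → length Y < length X → Halving Y) → Halving X
  halving-step X ih v with _∈?_ _≟_ v X
  ... | yes v∈X = ≤-trans (M-anti {v ∷ X} {X} λ { (here refl) → v∈X ; (there p) → p }) (m≤m+n (M (v ∷ X)) _)
  ... | no v∉X = +-cancelˡ-≤ (M X) _ _ (begin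
    M X + M X                       ≡⟨ cong (M X +_) (sym (+-identityʳ (M X))) ⟩
    2 * M X                         ≤⟨ *-monoʳ-≤ 2 split ⟩
    2 * (M (v ∷ X) + B Ev)          ≡⟨ *-distribˡ-+ 2 (M (v ∷ X)) (B Ev) ⟩
    2 * M (v ∷ X) + 2 * B Ev        ≤⟨ +-monoʳ-≤ (2 * M (v ∷ X)) few ⟩
    2 * M (v ∷ X) + M X             ≡⟨ +-comm (2 * M (v ∷ X)) (M X) ⟩
    M X + 2 * M (v ∷ X)             ∎)
    where
    open ≤-Reasoning
    v∈E? = _∈?_ _≟_ v
    Ev : List (List (Fin n))
    Ev = filter v∈E? Es
    term : FourColoring n → List (Fin n) → ℕ
    term f e = ⟦ proper? X f ⟧ * ⟦ mono? f e ⟧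
    B : List (List (Fin n)) → ℕ
    B es = ∑ λ f → sum (map (term f) es)
    B-bound : ∀ es → All (λ e → 2 ^ r * ∑ (λ f → term f e) ≤ M X) es → 2 ^ r * B es ≤ length es * M X
    B-bound []       _        = ≤-reflexive (trans (cong (2 ^ r *_) (∑-0 n)) (*-zeroʳ (2 ^ r)))
    B-bound (e ∷ es) (b ∷ bs) = ≤-trans
      (≤-reflexive (trans (cong (2 ^ r *_) (∑-+ (λ f → term f e) (λ f → sum (map (term f) es)))) (*-distribˡ-+ (2 ^ r) _ (B es))))
      (+-mono-≤ b (B-bound es bs))
    few : 2 * B Ev ≤ M X
    few = *-cancelˡ-≤ (2 ^ r) {{m^n≢0 2 r}} (begin
      2 ^ r * (2 * B Ev)     ≡⟨ swap (2 ^ r) 2 (B Ev) ⟩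
      2 * (2 ^ r * B Ev)     ≤⟨ *-monoʳ-≤ 2 (B-bound Ev (All.tabulate λ {e} e∈ →
                                  let e∈Es , v∈e = ∈-filter⁻ v∈E? {xs = Es} e∈ in
                                  bad-bound X v e v∉X v∈e (All.lookup E-unique e∈Es) (All.lookup E-large e∈Es) ih)) ⟩
      2 * (length Ev * M X)  ≤⟨ *-monoʳ-≤ 2 (*-monoˡ-≤ (M X) (sparse v)) ⟩
      2 * (r * M X)          ≡⟨ *-assoc 2 r (M X) ⟨
      2 * r * M X            ≤⟨ *-monoˡ-≤ (M X) (2*m≤2^m r) ⟩
      2 ^ r * M X            ∎)
      where
      swap : ∀ a b c → a * (b * c) ≡ b * (a * c)
      swap = solve-∀
    -- An edge that fails on `v ∷ X` must contain `v`: otherwise it lies inside `X`, where `f` is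
    -- already proper. It therefore survives the filter and contributes to the sum.
    improper : ∀ f es → (∀ {e} → e ∈ es → e ∈ Es) → Proper X f → ¬ All (λ e → In (v ∷ X) e → ¬ Mono f e) es →
               0 < sum (map (term f) (filter v∈E? es))
    improper f [] _ _ ¬all = contradiction [] ¬all
    improper f (e ∷ es) es⊆ good ¬all with in? (v ∷ X) e →-dec ¬? (mono? f e)
    ... | yes ok with v∈E? e
    ...   | yes _ = ≤-trans (improper f es (es⊆ ∘ there) good (¬all ∘ (ok ∷_))) (m≤n+m _ (term f e))
    ...   | no  _ = improper f es (es⊆ ∘ there) good (¬all ∘ (ok ∷_))
    improper f (e ∷ es) es⊆ good ¬all | no ¬ok with v∈E? e
    ...   | yes _ = ≤-trans (*-mono-≤ {1} {_} {1} (⟦⟧-positive (proper? X f) good)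
                               (⟦⟧-positive (mono? f e) (decidable-stable (mono? f e) λ ¬m → ¬ok λ _ → ¬m))) (m≤m+n _ _)
    ...   | no v∉e = contradiction (λ inX → All.lookup good (es⊆ (here refl)) (All.tabulate λ u∈ → drop-v u∈ (All.lookup inX u∈))) ¬ok
      where
      drop-v : ∀ {u} → u ∈ e → u ∈ v ∷ X → u ∈ X
      drop-v u∈ (here refl) = contradiction u∈ v∉e
      drop-v u∈ (there p)   = p
    pointwise : ∀ f → ⟦ proper? X f ⟧ ≤ ⟦ proper? (v ∷ X) f ⟧ + sum (map (term f) Ev)
    pointwise f = ⟦⟧-cover (proper? X f) (proper? (v ∷ X) f) (improper f Es id)
    split : M X ≤ M (v ∷ X) + B Ev
    split = ≤-trans (∑-mono pointwise) (≤-reflexive (∑-+ (λ f → ⟦ proper? (v ∷ X) f ⟧) (λ f → sum (map (term f) Ev))))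

  halving : ∀ k X → length X < k → Halving X
  halving (suc k) X X<k = halving-step X λ Y Y<X → halving k Y (<-≤-trans Y<X (≤-pred X<k))

  M-positive : ∀ X → 0 < M X
  -- Only an empty edge could lie inside the empty set, and every edge has more than `r` vertices.
  M-positive [] = ∑-positive (λ f → ⟦ proper? [] f ⟧) λ f → ⟦⟧-positive (proper? [] f) (All.tabulate λ e∈ → λ { [] → contradiction (All.lookup E-large e∈) λ () ; (() ∷ _) })
  M-positive (v ∷ X) with M (v ∷ X) | M-positive X | halving (suc (length X)) X ≤-refl v
  ... | zero  | 0<M | M≤0 = contradiction (<-≤-trans 0<M M≤0) λ ()
  ... | suc _ | _   | _   = s≤s z≤n

  properColoring : ∃ λ (f : FourColoring n) → ∀ {e} → e ∈ Es → ∀ c → ∃ λ u → u ∈ e × Vec.lookup f u ≢ c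
  properColoring with f , 0<f ← ∑-positive⁻ (λ f → ⟦ proper? (allFin n) f ⟧) (M-positive (allFin n)) = f , λ {e} e∈ c →
    let u , u∈ , ne = Membership.find (Allₚ.¬All⇒Any¬ (λ u → Vec.lookup f u ≟ c) e
                        λ all → All.lookup (⟦⟧-positive⁻ (proper? (allFin n) f) 0<f) e∈
                          (All.tabulate λ _ → ∈-allFin _) (c , all))
    in u , u∈ , ne

-- Growing the tree

module _ {A : Set} where

  count-∪ : {P Q R : A → Set} (P? : Decidable P) (Q? : Decidable Q) (R? : Decidable R) →
            (∀ {x} → P x → R x) → (∀ {x} → Q x → R x) → (∀ {x} → P x → ¬ Q x) → ∀ xs →
            length (filter P? xs) + length (filter Q? xs) ≤ length (filter R? xs)
  count-∪ P? Q? R? P⇒R Q⇒R P#Q [] = z≤n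
  count-∪ P? Q? R? P⇒R Q⇒R P#Q (x ∷ xs) with ih ← count-∪ P? Q? R? P⇒R Q⇒R P#Q xs | P? x | Q? x | R? x
  ... | yes p | yes q | _     = contradiction q (P#Q p)
  ... | yes p | no _  | yes _ = s≤s ih
  ... | yes p | no _  | no ¬r = contradiction (P⇒R p) ¬r
  ... | no _  | yes q | yes _ = ≤-trans (≤-reflexive (+-suc _ _)) (s≤s ih)
  ... | no _  | yes q | no ¬r = contradiction (Q⇒R q) ¬r
  ... | no _  | no _  | yes _ = m≤n⇒m≤1+n ih
  ... | no _  | no _  | no _  = ih

  count-cover : {P Q R : A → Set} (P? : Decidable P) (Q? : Decidable Q) (R? : Decidable R) →
                (∀ {x} → R x → P x ⊎ Q x) → ∀ xs →
                length (filter R? xs) ≤ length (filter P? xs) + length (filter Q? xs)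
  count-cover P? Q? R? cover [] = z≤n
  count-cover P? Q? R? cover (x ∷ xs) with ih ← count-cover P? Q? R? cover xs | R? x | P? x | Q? x
  ... | yes _ | yes _ | yes _ = s≤s (≤-trans ih (+-monoʳ-≤ _ (n≤1+n _)))
  ... | yes _ | yes _ | no _  = s≤s ih
  ... | yes _ | no _  | yes _ = ≤-trans (s≤s ih) (≤-reflexive (sym (+-suc _ _)))
  ... | no _  | yes _ | yes _ = ≤-trans ih (+-mono-≤ (n≤1+n _) (n≤1+n _))
  ... | no _  | yes _ | no _  = m≤n⇒m≤1+n ih
  ... | no _  | no _  | yes _ = ≤-trans ih (+-monoʳ-≤ _ (n≤1+n _))
  ... | no _  | no _  | no _  = ih
  ... | yes r | no ¬p | no ¬q with cover r
  ...   | inj₁ p = contradiction p ¬p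
  ...   | inj₂ q = contradiction q ¬q

  count-filter : {P Q R : A → Set} (P? : Decidable P) (Q? : Decidable Q) (R? : Decidable R) →
                 (∀ {x} → P x → Q x → R x) → ∀ xs →
                 length (filter Q? (filter P? xs)) ≤ length (filter R? xs)
  count-filter P? Q? R? imp [] = z≤n
  count-filter P? Q? R? imp (x ∷ xs) with ih ← count-filter P? Q? R? imp xs | P? x
  count-filter P? Q? R? imp (x ∷ xs) | yes p with Q? x | R? x
  ... | yes _ | yes _ = s≤s ih
  ... | yes q | no ¬r = contradiction (imp p q) ¬r
  ... | no _  | yes _ = m≤n⇒m≤1+n ih
  ... | no _  | no _  = ih
  count-filter P? Q? R? imp (x ∷ xs) | no _ with R? x
  ... | yes _ = m≤n⇒m≤1+n ih
  ... | no _  = ih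

  count-map : {B : Set} {P : B → Set} (P? : Decidable P) (f : A → B) → ∀ xs →
              length (filter P? (map f xs)) ≡ length (filter (P? ∘ f) xs)
  count-map P? f [] = refl
  count-map P? f (x ∷ xs) with P? (f x)
  ... | yes _ = cong suc (count-map P? f xs)
  ... | no _  = count-map P? f xs

-- Neighbourhoods, domination and trees

module Adjacency {n : ℕ} (G : Graph n) where

  _~_ : Fin n → Fin n → Set
  u ~ v = adj G u v ≡ true

  _~?_ : ∀ u v → Dec (u ~ v)
  u ~? v = adj G u v Bool.≟ true

  ~-sym : ∀ {u v} → u ~ v → v ~ u
  ~-sym {u} {v} u~v = trans (Graph.sym G v u) u~v

  # : {P : Fin n → Set} → Decidable P → ℕ
  # P? = length (filter P? (allFin n))

  degree≡# : ∀ v → degree G v ≡ # (v ~?_)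
  degree≡# v = go (allFin n)
    where
    go : ∀ xs → sum (map (λ u → if adj G v u then 1 else 0) xs) ≡ length (filter (v ~?_) xs)
    go [] = refl
    go (x ∷ xs) with adj G v x
    ... | true  = cong suc (go xs)
    ... | false = go xs

  Near : Fin n → Fin n → Set
  Near v u = v ≡ u ⊎ v ~ u

  near? : ∀ v → Decidable (Near v)
  near? v u = (v ≟ u) ⊎-dec (v ~? u)

  degree<#near : ∀ v → degree G v < # (near? v)
  degree<#near v = begin-strict
    degree G v                 ≡⟨ degree≡# v ⟩
    # (v ~?_)                  <⟨ +-monoˡ-≤ (# (v ~?_)) (∈-length (∈-filter⁺ (v ≟_) (∈-allFin v) refl)) ⟩
    # (v ≟_) + # (v ~?_)       ≤⟨ count-∪ (v ≟_) (v ~?_) (near? v) inj₁ inj₂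
                                    (λ { refl v~v → contradiction (trans (sym v~v) (irrefl G v)) λ () }) (allFin n) ⟩
    # (near? v)                ∎
    where open ≤-Reasoning

  -- Membership in the closed neighbourhood N[L].
  Dom : List (Fin n) → Fin n → Set
  Dom L v = Any (λ s → Near s v) L

  dom? : ∀ L → Decidable (Dom L)
  dom? L v = Any.any? (λ s → near? s v) L

  ∈⇒Dom : ∀ {L v} → v ∈ L → Dom L v
  ∈⇒Dom = Any.map (inj₁ ∘ sym)

  ~∈⇒Dom : ∀ {L s v} → s ∈ L → s ~ v → Dom L v
  ~∈⇒Dom s∈L s~v = Any.map (λ { refl → inj₂ s~v }) s∈L

  Dom-neighbour : ∀ {L v} → Dom L v → v ∉ L → ∃ λ s → s ∈ L × v ~ s
  Dom-neighbour d v∉L with Membership.find d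
  ... | s , s∈L , inj₁ refl = contradiction s∈L v∉L
  ... | s , s∈L , inj₂ s~v  = s , s∈L , ~-sym s~v

  -- A subtree listed in reverse order of growth: the root comes last, and every other vertex has
  -- its parent further down the list.
  data Tree : List (Fin n) → Set where
    root : ∀ v → Tree (v ∷ [])
    grow : ∀ {L v p} → v ∉ L → p ∈ L → v ~ p → Tree L → Tree (v ∷ L)

  gain? : ∀ L s → Decidable (λ u → Near s u × ¬ Dom L u)
  gain? L s u = near? s u ×-dec ¬? (dom? L u)

  gain : List (Fin n) → Fin n → ℕ
  gain L s = # (gain? L s)

  #dom+gain : ∀ {L L′ s} → (∀ {v} → v ∈ L → v ∈ L′) → s ∈ L′ → # (dom? L) + gain L s ≤ # (dom? L′)
  #dom+gain {L} {L′} {s} L⊆L′ s∈L′ = count-∪ (dom? L) (gain? L s) (dom? L′)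
    (λ d → let t , t∈ , near = Membership.find d in Membership.lose (L⊆L′ t∈) near)
    (λ { (near , _) → Membership.lose s∈L′ near })
    (λ { d (_ , ¬d) → ¬d d }) (allFin n)

  -- The vertices at distance exactly 2 from `L`.
  Second : List (Fin n) → Fin n → Set
  Second L v = ¬ Dom L v × ∃ λ a → v ~ a × Dom L a

  second? : ∀ L → Decidable (Second L)
  second? L v = ¬? (dom? L v) ×-dec any? λ a → (v ~? a) ×-dec dom? L a

-- Greedy growth to a saturated tree

module Growth {n : ℕ} (G : Graph n) (δ : ℕ) (connected : Connected G) (δ≤deg : ∀ v → δ ≤ degree G v) where

  open Adjacency G

  -- Adding `c` vertices is affordable if it dominates at least c (δ + 1) / 3 new ones. The three
  -- fields say that the moves with `c` equal to 1, 2 and 3 are exhausted.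
  record Saturated (L : List (Fin n)) : Set where
    field
      dominated-gain : ∀ a → Dom L a → 3 * gain L a ≤ δ
      second-gain    : ∀ x → Second L x → 3 * gain L x < 2 * suc δ
      two-step       : ∀ v → Dom L v ⊎ Second L v

  -- The gain of the single vertex `s` has to pay for all `c` new vertices. The clause
  -- `suc δ ≤ 3 * gain L s` makes this gain positive, which drives the termination of `saturate`.
  Extension : List (Fin n) → Set
  Extension L = ∃ λ c → ∃ λ L′ → ∃ λ s →
    Tree L′ × length L′ ≡ c + length L × (∀ {v} → v ∈ L → v ∈ L′) × s ∈ L′ × suc δ ≤ 3 * gain L s × c * suc δ ≤ 3 * gain L s

  attach : ∀ {L a} → Tree L → Dom L a → a ∉ L → Tree (a ∷ L)
  attach tree d a∉L = let s , s∈L , a~s = Dom-neighbour d a∉L in grow a∉L s∈L a~s tree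

  attach-second : ∀ {L x} → Tree L → (sec : Second L x) → Tree (x ∷ proj₁ (proj₂ sec) ∷ L)
  attach-second {L} {x} tree (¬d , a , x~a , da) = grow x∉ (here refl) x~a (attach tree da a∉L)
    where
    a∉L : a ∉ L
    a∉L a∈L = ¬d (~∈⇒Dom a∈L (~-sym x~a))
    x∉ : x ∉ a ∷ L
    x∉ (here refl) = ¬d da
    x∉ (there x∈L) = ¬d (∈⇒Dom x∈L)

  -- A vertex beyond distance 2 has no dominated neighbour, so on its way to N[L] the walk must
  -- first enter the second level, and it does so from a vertex beyond it.
  far-edge : ∀ {L u v} → Walk G u v → ¬ Dom L u → ¬ Second L u → Dom L v →
             ∃ λ z → ∃ λ x → ¬ Dom L z × ¬ Second L z × z ~ x × Second L x
  far-edge [] ¬d _ d = contradiction d ¬d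
  far-edge {L} {u} (step {w = w} u~w p) ¬d ¬s d with dom? L w | second? L w
  ... | yes dw | _      = contradiction (¬d , w , u~w , dw) ¬s
  ... | no  _  | yes sw = u , w , ¬d , ¬s , u~w , sw
  ... | no ¬dw | no ¬sw = far-edge p ¬dw ¬sw d

  extend-far : ∀ {L} → Tree L → ∃ (λ v → ¬ Dom L v × ¬ Second L v) → Extension L
  extend-far {L} tree (v , ¬dv , ¬sv) with far-edge (connected v (head tree)) ¬dv ¬sv (∈⇒Dom (head∈ tree))
    where
    head : ∀ {L} → Tree L → Fin n
    head (root v) = v
    head (grow {v = v} _ _ _ _) = v
    head∈ : ∀ {L} (t : Tree L) → head t ∈ L
    head∈ (root v) = here refl
    head∈ (grow _ _ _ _) = here refl
  ... | z , x , ¬dz , ¬sz , z~x , sx@(_ , a , _ , da) =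
    3 , z ∷ x ∷ a ∷ L , z , grow z∉ (here refl) z~x (attach-second tree sx) , refl
      , there ∘ there ∘ there , here refl , ≤-trans (m≤m+n (suc δ) _) bound , bound
    where
    z∉ : z ∉ x ∷ a ∷ L
    z∉ (here refl)           = ¬sz sx
    z∉ (there (here refl))   = ¬dz da
    z∉ (there (there z∈L))   = ¬dz (∈⇒Dom z∈L)
    -- As `z` is neither dominated nor at distance 2, its whole closed neighbourhood is new. The
    -- second class given to `count-cover` is empty, so the cover is a plain inclusion.
    bound : 3 * suc δ ≤ 3 * gain L z
    bound = *-monoʳ-≤ 3 (≤-trans (s≤s (δ≤deg z)) (≤-trans (degree<#near z)
      (≤-trans (count-cover (gain? L z) (λ _ → no id) (near? z)
                 (λ { (inj₁ refl) → inj₁ (inj₁ refl , ¬dz)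
                    ; (inj₂ z~u) → inj₁ (inj₂ z~u , λ du → ¬sz (¬dz , _ , z~u , du)) }) (allFin n))
        (≤-reflexive (trans (cong (gain L z +_) (cong length (filter-none (λ _ → no id) (All.tabulate {xs = allFin n} λ _ ()))))
                            (+-identityʳ _))))))

  saturate-step : ∀ L → Tree L → Extension L ⊎ Saturated L
  saturate-step L tree
    with any? (λ a → dom? L a ×-dec (suc δ ≤? 3 * gain L a))
       | any? (λ x → second? L x ×-dec (2 * suc δ ≤? 3 * gain L x))
       | any? (λ v → ¬? (dom? L v) ×-dec ¬? (second? L v))
  ... | _ | yes (x , sx@(_ , a , _) , large) | _ = inj₁ (2 , x ∷ a ∷ L , x , attach-second tree sx , refl
          , there ∘ there , here refl , ≤-trans (m≤m+n (suc δ) _) large , large)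
  ... | _ | _ | yes far = inj₁ (extend-far tree far)
  ... | yes (a , da , large) | _ | _ with _∈?_ _≟_ a L
  ...   | no a∉L = inj₁ (1 , a ∷ L , a , attach tree da a∉L , refl , there , here refl , large
                        , ≤-trans (≤-reflexive (*-identityˡ _)) large)
  ...   | yes a∈L = contradiction (subst (λ g → suc δ ≤ 3 * g) no-gain large) λ ()
    where
    -- A tree vertex dominates nothing new, since adding it does not change N[L].
    no-gain : gain L a ≡ 0
    no-gain = n≤0⇒n≡0 (+-cancelˡ-≤ (# (dom? L)) _ _
      (≤-trans (#dom+gain {L} {L} id a∈L) (≤-reflexive (sym (+-identityʳ _)))))
  saturate-step L tree | no ¬1 | no ¬2 | no ¬3 = inj₂ record
    { dominated-gain = λ a da → ≤-pred (≰⇒> λ large → ¬1 (a , da , large))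
    ; second-gain    = λ x sx → ≰⇒> λ large → ¬2 (x , sx , large)
    ; two-step       = two-step }
    where
    two-step : ∀ v → Dom L v ⊎ Second L v
    two-step v with dom? L v | second? L v
    ... | yes d | _     = inj₁ d
    ... | no _  | yes s = inj₂ s
    ... | no ¬d | no ¬s = contradiction (v , ¬d , ¬s) ¬3

  #≤n : {P : Fin n → Set} (P? : Decidable P) → # P? ≤ n
  #≤n P? = ≤-trans (length-filter P? (allFin n)) (≤-reflexive (length-tabulate id))

  -- `k` is fuel: each extension dominates at least one new vertex, and at most `n` can be
  -- dominated.
  saturate : ∀ k L → Tree L → length L * suc δ ≤ 3 * # (dom? L) → n < k + # (dom? L) →
             ∃ λ L′ → Tree L′ × length L′ * suc δ ≤ 3 * n × Saturated L′
  saturate zero L tree size n< = contradiction (#≤n (dom? L)) (<⇒≱ n<)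
  saturate (suc k) L tree size n< with saturate-step L tree
  ... | inj₂ sat = L , tree , ≤-trans size (*-monoʳ-≤ 3 (#≤n (dom? L))) , sat
  ... | inj₁ (c , L′ , s , tree′ , len , L⊆L′ , s∈L′ , some , cheap) = saturate k L′ tree′ size′ n<′
    where
    open ≤-Reasoning
    more : # (dom? L) + gain L s ≤ # (dom? L′)
    more = #dom+gain {L} {L′} L⊆L′ s∈L′
    size′ : length L′ * suc δ ≤ 3 * # (dom? L′)
    size′ = begin
      length L′ * suc δ                      ≡⟨ cong (_* suc δ) len ⟩
      (c + length L) * suc δ                 ≡⟨ *-distribʳ-+ (suc δ) c (length L) ⟩
      c * suc δ + length L * suc δ           ≤⟨ +-mono-≤ cheap size ⟩
      3 * gain L s + 3 * # (dom? L)          ≡⟨ *-distribˡ-+ 3 (gain L s) _ ⟨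
      3 * (gain L s + # (dom? L))            ≡⟨ cong (3 *_) (+-comm (gain L s) _) ⟩
      3 * (# (dom? L) + gain L s)            ≤⟨ *-monoʳ-≤ 3 more ⟩
      3 * # (dom? L′)                        ∎
    gain>0 : ∀ g → suc δ ≤ 3 * g → 1 ≤ g
    gain>0 (suc g) _ = s≤s z≤n
    n<′ : n < k + # (dom? L′)
    n<′ = begin-strict
      n                           <⟨ n< ⟩
      suc k + # (dom? L)          ≡⟨ +-suc k _ ⟨
      k + suc (# (dom? L))        ≡⟨ cong (k +_) (+-comm 1 _) ⟩
      k + (# (dom? L) + 1)        ≤⟨ +-monoʳ-≤ k (+-monoʳ-≤ _ (gain>0 _ some)) ⟩
      k + (# (dom? L) + gain L s) ≤⟨ +-monoʳ-≤ k more ⟩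
      k + # (dom? L′)             ∎

  saturated-tree : Fin n → ∃ λ L → Tree L × length L * suc δ ≤ 3 * n × Saturated L
  saturated-tree v = saturate (suc n) (v ∷ []) (root v) size (m≤m+n (suc n) _)
    where
    open ≤-Reasoning
    size : 1 * suc δ ≤ 3 * # (dom? (v ∷ []))
    size = begin
      1 * suc δ                                ≡⟨ *-identityˡ (suc δ) ⟩
      suc δ                                    ≤⟨ s≤s (δ≤deg v) ⟩
      suc (degree G v)                         ≤⟨ degree<#near v ⟩
      # (near? v)                              ≤⟨ m≤m+n _ _ ⟩
      # (near? v) + # {λ _ → ⊥} (λ _ → no id)  ≤⟨ count-∪ (near? v) (λ _ → no id) (dom? (v ∷ [])) here (λ ()) (λ _ ()) (allFin n) ⟩
      # (dom? (v ∷ []))                        ≤⟨ m≤m+n _ _ ⟩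
      3 * # (dom? (v ∷ []))                    ∎

  -- The hypergraph of neighbourhoods of second-level vertices

  module _ {L : List (Fin n)} (sat : Saturated L) where
    open Saturated sat

    link? : ∀ x → Decidable (λ u → x ~ u × Dom L u)
    link? x u = (x ~? u) ×-dec dom? L u

    links : Fin n → List (Fin n)
    links x = filter (link? x) (allFin n)

    -- The closed neighbourhood of `x` has at least δ + 1 vertices. Fewer than two thirds of δ + 1
    -- are undominated by `second-gain`, and the others are links.
    second-links : ∀ x → Second L x → δ / 3 < length (links x)
    second-links x sx@(¬dx , _) = m<n*o⇒m/o<n (≤-pred (begin
      suc (suc δ)                                ≤⟨ +-cancelˡ-≤ (2 * suc δ) _ _ enough ⟩
      3 * length (links x)                       ≡⟨ *-comm 3 (length (links x)) ⟩
      length (links x) * 3                       ≤⟨ n≤1+n _ ⟩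
      suc (length (links x) * 3)                 ∎))
      where
      open ≤-Reasoning
      split : suc δ ≤ gain L x + length (links x)
      split = ≤-trans (s≤s (δ≤deg x)) (≤-trans (degree<#near x)
        (count-cover (gain? L x) (link? x) (near? x) cover (allFin n)))
        where
        cover : ∀ {u} → Near x u → (Near x u × ¬ Dom L u) ⊎ (x ~ u × Dom L u)
        cover {u} near with dom? L u
        ... | no ¬du = inj₁ (near , ¬du)
        ... | yes du with near
        ...   | inj₁ refl = contradiction du ¬dx
        ...   | inj₂ x~u  = inj₂ (x~u , du)
      enough : 2 * suc δ + suc (suc δ) ≤ 2 * suc δ + 3 * length (links x)
      enough = begin
        2 * suc δ + suc (suc δ)              ≡⟨ triple (suc δ) ⟩
        suc (3 * suc δ)                      ≤⟨ s≤s (*-monoʳ-≤ 3 split) ⟩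
        suc (3 * (gain L x + length (links x))) ≡⟨ cong suc (*-distribˡ-+ 3 (gain L x) _) ⟩
        suc (3 * gain L x) + 3 * length (links x) ≤⟨ +-monoˡ-≤ _ (second-gain x sx) ⟩
        2 * suc δ + 3 * length (links x)     ∎
        where
        triple : ∀ d → 2 * d + suc d ≡ suc (3 * d)
        triple = solve-∀

    undominated : List (Fin n)
    undominated = filter (¬? ∘ dom? L) (allFin n)

    -- The hyperedges through a dominated `v` come from undominated neighbours of `v`, which
    -- `gain L v` counts. An undominated `v` lies in no hyperedge.
    links-sparse : ∀ v → length (filter (_∈?_ _≟_ v) (map links undominated)) ≤ δ / 3
    links-sparse v with dom? L v
    ... | no ¬dv = ≤-trans (≤-reflexive (cong length (filter-none (_∈?_ _≟_ v) (All.tabulate none)))) z≤n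
      where
      none : ∀ {e} → e ∈ map links undominated → v ∉ e
      none e∈ v∈e with x , _ , refl ← ∈-map⁻ links e∈ = ¬dv (proj₂ (proj₂ (∈-filter⁻ (link? x) {xs = allFin n} v∈e)))
    ... | yes dv = begin
      length (filter (_∈?_ _≟_ v) (map links undominated))  ≡⟨ count-map (_∈?_ _≟_ v) links undominated ⟩
      length (filter (_∈?_ _≟_ v ∘ links) undominated)      ≤⟨ count-filter (¬? ∘ dom? L) (_∈?_ _≟_ v ∘ links) (gain? L v) linked (allFin n) ⟩
      gain L v                                              ≤⟨ third (gain L v) (dominated-gain v dv) ⟩
      δ / 3                                                 ∎
      where
      open ≤-Reasoning
      linked : ∀ {x} → ¬ Dom L x → v ∈ links x → Near v x × ¬ Dom L x
      linked {x} ¬dx v∈ = inj₂ (~-sym (proj₁ (proj₂ (∈-filter⁻ (link? x) {xs = allFin n} v∈)))) , ¬dx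
      third : ∀ g → 3 * g ≤ δ → g ≤ δ / 3
      third g 3g≤δ = ≤-trans (≤-reflexive (sym (m*n/n≡m g 3))) (/-monoˡ-≤ 3 (≤-trans (≤-reflexive (*-comm g 3)) 3g≤δ))

    -- That no hyperedge is monochromatic is used in this form: whichever type has to be avoided,
    -- `x` has a dominated neighbour of another type.
    second-types : ∃ λ (τ : Fin n → Fin 4) → ∀ x → Second L x → ∀ c → ∃ λ b → x ~ b × Dom L b × τ b ≢ c
    second-types = Vec.lookup f , λ x sx c →
      let b , b∈ , ne = good (∈-map⁺ links (∈-filter⁺ (¬? ∘ dom? L) (∈-allFin x) (proj₁ sx))) c
          x~b , db = proj₂ (∈-filter⁻ (link? x) {xs = allFin n} b∈)
      in b , x~b , db , ne
      where
      on-undominated : {P : List (Fin n) → Set} → (∀ x → ¬ Dom L x → P (links x)) → All P (map links undominated)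
      on-undominated {P} h = All.tabulate λ e∈ → let x , x∈ , eq = ∈-map⁻ links e∈ in
        subst P (sym eq) (h x (proj₂ (∈-filter⁻ (¬? ∘ dom? L) {xs = allFin n} x∈)))
      to-second : ∀ x → ¬ Dom L x → Second L x
      to-second x ¬d with two-step x
      ... | inj₁ d = contradiction d ¬d
      ... | inj₂ s = s
      open Hypergraph (map links undominated) (δ / 3)
        (on-undominated λ x _ → Uniqueₚ.filter⁺ (link? x) (Uniqueₚ.allFin⁺ n))
        (on-undominated λ x ¬d → second-links x (to-second x ¬d))
        links-sparse
      f = proj₁ properColoring
      good = proj₂ properColoring

-- Rainbow walks

module RainbowWalks {n : ℕ} (G : Graph n) {C : Set} (vc : Fin n → C) (ec : Fin n → Fin n → C)
  (ec-sym : ∀ u v → ec u v ≡ ec v u) where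

  colors : ∀ {u v} → Walk G u v → List C
  colors []                                = []
  colors (step {u} {w} _ [])               = ec u w ∷ []
  colors (step {u} {w} _ (step u~w p))     = ec u w ∷ vc w ∷ colors (step u~w p)

  infixr 5 _++ʷ_
  _++ʷ_ : ∀ {u w v} → Walk G u w → Walk G w v → Walk G u v
  []         ++ʷ q = q
  step u~w p ++ʷ q = step u~w (p ++ʷ q)

  ++ʷ-identityʳ : ∀ {u v} (p : Walk G u v) → p ++ʷ [] ≡ p
  ++ʷ-identityʳ []           = refl
  ++ʷ-identityʳ (step u~w p) = cong (step u~w) (++ʷ-identityʳ p)

  colors-++ʷ : ∀ {u x w y v} (e : adj G u x ≡ true) (p : Walk G x w) (f : adj G w y ≡ true) (q : Walk G y v) →
               colors (step e p ++ʷ step f q) ≡ colors (step e p) ++ vc w ∷ colors (step f q)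
  colors-++ʷ e []          f q = refl
  colors-++ʷ e (step e′ p) f q = cong (λ cs → _ ∷ _ ∷ cs) (colors-++ʷ e′ p f q)

  -- The predicate `P` records which colors may occur, so that walks can be joined by comparing
  -- predicates instead of color lists. Repeated vertices are allowed here and removed by
  -- `erase-loops`.
  record Rainbow (P : C → Set) (u v : Fin n) : Set where
    constructor rainbow
    field
      walk   : Walk G u v
      unique : Unique (colors walk)
      within : All P (colors walk)

  weaken : ∀ {P Q u v} → (∀ {c} → P c → Q c) → Rainbow P u v → Rainbow Q u v
  weaken P⇒Q (rainbow p uniq all) = rainbow p uniq (All.map P⇒Q all)

  stay : ∀ {P v} → Rainbow P v v
  stay = rainbow [] [] []

  edge : ∀ {u w c} → adj G u w ≡ true → ec u w ≡ c → Rainbow (_≡ c) u w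
  edge u~w eq = rainbow (step u~w []) ([] ∷ []) (eq ∷ [])

  Via : (C → Set) → Fin n → (C → Set) → C → Set
  Via P w Q c = P c ⊎ (c ≡ vc w ⊎ Q c)

  -- The junction `w` becomes an internal vertex, so its color must be new to both walks. If one of
  -- the walks is empty, `w` stays an end and its color does not enter.
  concatenate : ∀ {P Q u w v} → Rainbow P u w → Rainbow Q w v →
         (∀ {c} → P c → ¬ Q c) → ¬ P (vc w) → ¬ Q (vc w) → Rainbow (Via P w Q) u v
  concatenate (rainbow [] _ _) q _ _ _ = weaken (inj₂ ∘ inj₂) q
  concatenate {P} {Q} {u} {w} (rainbow (step e p) uniq all) (rainbow [] _ _) _ _ _ =
    rainbow (step e p ++ʷ [])
      (subst (Unique ∘ colors) (sym (++ʷ-identityʳ (step e p))) uniq)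
      (subst (All (Via P w Q) ∘ colors) (sym (++ʷ-identityʳ (step e p))) (All.map inj₁ all))
  concatenate {P} {Q} {w = w} (rainbow (step e p) uniqP allP) (rainbow (step f q) uniqQ allQ) P#Q ¬Pw ¬Qw =
    rainbow (step e p ++ʷ step f q)
      (subst Unique (sym (colors-++ʷ e p f q))
        (Uniqueₚ.++⁺ uniqP (All.map (λ Qc eq → ¬Qw (subst Q (sym eq) Qc)) allQ ∷ uniqQ)
          λ { (c∈P , here refl)  → ¬Pw (All.lookup allP c∈P)
            ; (c∈P , there c∈Q) → P#Q (All.lookup allP c∈P) (All.lookup allQ c∈Q) }))
      (subst (All (Via P w Q)) (sym (colors-++ʷ e p f q))
        (Allₚ.++⁺ (All.map inj₁ allP) (inj₂ (inj₁ refl) ∷ All.map (inj₂ ∘ inj₂) allQ)))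

  reverse-walk : ∀ {u v} (p : Walk G u v) → Unique (colors p) → Rainbow (_∈ colors p) v u
  reverse-walk [] _ = stay
  reverse-walk (step {u} {w} e []) _ =
    weaken here (edge (trans (Graph.sym G w u) e) (ec-sym w u))
  reverse-walk (step {u} {w} e p@(step _ _)) ((ec≢vc ∷ ec∉) ∷ (vc∉ ∷ uniq)) = weaken into
    (concatenate (reverse-walk p uniq) (edge (trans (Graph.sym G w u) e) (ec-sym w u))
      (λ c∈p → λ { refl → All.lookup ec∉ c∈p refl }) (λ vc∈p → All.lookup vc∉ vc∈p refl) (ec≢vc ∘ sym))
    where
    into : ∀ {c} → Via (_∈ colors p) w (_≡ ec u w) c → c ∈ ec u w ∷ vc w ∷ colors p
    into (inj₁ c∈)            = there (there c∈)
    into (inj₂ (inj₁ refl))   = there (here refl)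
    into (inj₂ (inj₂ refl))   = here refl

  reverse : ∀ {P u v} → Rainbow P u v → Rainbow P v u
  reverse (rainbow p uniq all) = weaken (All.lookup all) (reverse-walk p uniq)

  RainbowPath : (C → Set) → Fin n → Fin n → Set
  RainbowPath P u v = Σ (Rainbow P u v) (IsPath G ∘ Rainbow.walk)

  unique-tail : ∀ {u w v} (e : adj G u w ≡ true) (p : Walk G w v) → Unique (colors (step e p)) → Unique (colors p)
  unique-tail e []         _              = []
  unique-tail e (step _ _) (_ ∷ _ ∷ uniq) = uniq

  all-tail : ∀ {P : C → Set} {u w v} (e : adj G u w ≡ true) (p : Walk G w v) → All P (colors (step e p)) → All P (colors p)
  all-tail e []         _             = []
  all-tail e (step _ _) (_ ∷ _ ∷ all) = all

  suffix : ∀ {P u w v} (p : Walk G w v) → IsPath G p → Unique (colors p) → All P (colors p) →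
           u ∈ vertices G p → RainbowPath P u v
  suffix []         path       uniq all (here refl) = rainbow [] uniq all , path
  suffix (step e p) path       uniq all (here refl) = rainbow (step e p) uniq all , path
  suffix (step e p) (_ ∷ path) uniq all (there u∈)  = suffix p path (unique-tail e p uniq) (all-tail e p all) u∈

  -- The tail is first made into a path; if that path returns to `u`, its suffix from there is
  -- taken. Colors are only dropped, so they stay distinct.
  erase-loops : ∀ {P u v} (p : Walk G u v) → Unique (colors p) → All P (colors p) → RainbowPath P u v
  erase-loops [] _ _ = stay , [] ∷ []
  erase-loops {u = u} (step {w = w} e []) uniq all = rainbow (step e []) uniq all , (u≢w ∷ []) ∷ ([] ∷ [])
    where
    u≢w : u ≢ w
    u≢w refl = contradiction (trans (sym e) (irrefl G u)) λ ()
  erase-loops {P} {u} {v} (step {w = w} e p@(step _ _)) ((ec≢vc ∷ ec∉) ∷ (vc∉ ∷ uniq)) (Pec ∷ Pvc ∷ all)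
    -- The new tail is known only through its predicate, which therefore also records that its
    -- colors differ from those of the first edge and of `w`.
    with rainbow q uniq-q all-q , path ← erase-loops p uniq (All.zip (all , All.zip (ec∉ , vc∉)))
       | _∈?_ _≟_ u (vertices G q)
  ... | yes u∈ = suffix q path uniq-q (All.map proj₁ all-q) u∈
  ... | no u∉  = rainbow (step e q) (unique-step q uniq-q all-q) (all-step q all-q) , Allₚ.¬Any⇒All¬ _ u∉ ∷ path
    where
    unique-step : ∀ (q : Walk G w v) → Unique (colors q) →
                  All (λ c → P c × ec u w ≢ c × vc w ≢ c) (colors q) → Unique (colors (step e q))
    unique-step []         _  _   = [] ∷ []
    unique-step (step _ _) un alq = (ec≢vc ∷ All.map (proj₁ ∘ proj₂) alq) ∷ (All.map (proj₂ ∘ proj₂) alq ∷ un)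
    all-step : ∀ (q : Walk G w v) → All (λ c → P c × ec u w ≢ c × vc w ≢ c) (colors q) → All P (colors (step e q))
    all-step []         _   = Pec ∷ []
    all-step (step _ _) alq = Pec ∷ Pvc ∷ All.map proj₁ alq

  rainbow-path : ∀ {P u v} → Rainbow P u v → RainbowPath P u v
  rainbow-path (rainbow p uniq all) = erase-loops p uniq all

colorable : ∀ {n k} (G : Graph n) {C : Set} (vc : Fin n → C) (ec : Fin n → Fin n → C) (ec-sym : ∀ u v → ec u v ≡ ec v u)
            (enc : C → Fin k) → (∀ {c d} → enc c ≡ enc d → c ≡ d) →
            (∀ u v → ∃ λ P → RainbowWalks.Rainbow G vc ec ec-sym P u v) → TRCColorable G k
colorable {n} {k} G vc ec ec-sym enc enc-injective connect = coloring , λ u v →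
  let rainbow p uniq _ , path = rainbow-path (proj₂ (connect u v)) in
  p , path , subst Unique (sym (encoded p)) (Uniqueₚ.map⁺ enc-injective uniq)
  where
  open RainbowWalks G vc ec ec-sym
  coloring : TotalColoring G k
  coloring = record { vcol = enc ∘ vc ; ecol = λ u v → enc (ec u v) ; ecol-sym = λ u v → cong enc (ec-sym u v) }
  encoded : ∀ {u v} (p : Walk G u v) → totalColors G coloring p ≡ map enc (colors p)
  encoded []                  = refl
  encoded (step _ [])         = refl
  encoded (step _ (step e p)) = cong (λ cs → _ ∷ _ ∷ cs) (encoded (step e p))

-- The total coloring

-- The characteristic function of a maximal independent set is such a labelling.
opposite-labelling : ∀ {n} (R : Fin n → Fin n → Set) → (∀ u v → Dec (R u v)) →
                     (∀ {u v} → R u v → R v u) → (∀ {v} → ¬ R v v) →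
                     ∃ λ (σ : Fin n → Bool) → ∀ {u v} → R u v → ∃ λ w → R u w × σ w ≢ σ u
opposite-labelling {n} R R? R-sym R-irrefl = σ , opposite
  where
  Stable : (Fin n → Bool) → Set
  Stable I = ∀ {u v} → R u v → I u ≡ true → I v ≡ true → ⊥
  Covered : (Fin n → Bool) → Fin n → Set
  Covered I u = I u ≡ true ⊎ ∃ λ w → R u w × I w ≡ true
  greedy : ∀ xs → ∃ λ I → Stable I × (∀ {u} → u ∈ xs → Covered I u)
  greedy [] = (λ _ → false) , (λ _ ()) , λ ()
  greedy (x ∷ xs) with greedy xs
  ... | I , indep , covered with any? (λ w → R? x w ×-dec (I w Bool.≟ true))
  ...   | yes (w , Rxw , Iw) = I , indep , λ { (here refl) → inj₂ (w , Rxw , Iw) ; (there u∈) → covered u∈ }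
  ...   | no ¬blocked = I′ , indep′ , λ { (here refl) → inj₁ (I′x refl) ; (there u∈) → grow-cover (covered u∈) }
    where
    I′ : Fin n → Bool
    I′ u = does (u ≟ x) ∨ I u
    I′x : ∀ {u} → u ≡ x → I′ u ≡ true
    I′x {u} eq with u ≟ x
    ... | yes _ = refl
    ... | no ne = contradiction eq ne
    I⇒I′ : ∀ {u} → I u ≡ true → I′ u ≡ true
    I⇒I′ {u} Iu with u ≟ x
    ... | yes _ = refl
    ... | no _  = Iu
    I′⁻ : ∀ {u} → I′ u ≡ true → u ≡ x ⊎ I u ≡ true
    I′⁻ {u} I′u with u ≟ x
    ... | yes eq = inj₁ eq
    ... | no _   = inj₂ I′u
    grow-cover : ∀ {u} → Covered I u → Covered I′ u
    grow-cover (inj₁ Iu)             = inj₁ (I⇒I′ Iu)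
    grow-cover (inj₂ (w , Ruw , Iw)) = inj₂ (w , Ruw , I⇒I′ Iw)
    indep′ : Stable I′
    indep′ Ruv I′u I′v with I′⁻ I′u | I′⁻ I′v
    ... | inj₁ refl | inj₁ refl = R-irrefl Ruv
    ... | inj₁ refl | inj₂ Iv   = ¬blocked (_ , Ruv , Iv)
    ... | inj₂ Iu   | inj₁ refl = ¬blocked (_ , R-sym Ruv , Iu)
    ... | inj₂ Iu   | inj₂ Iv   = indep Ruv Iu Iv
  σ : Fin n → Bool
  σ = proj₁ (greedy (allFin n))
  opposite : ∀ {u v} → R u v → ∃ λ w → R u w × σ w ≢ σ u
  opposite {u} {v} Ruv with σ u in σu | proj₂ (proj₂ (greedy (allFin n))) (∈-allFin u)
  ... | true  | _ = v , Ruv , λ σv → proj₁ (proj₂ (greedy (allFin n))) Ruv σu σv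
  ... | false | inj₁ ()
  ... | false | inj₂ (w , Ruw , σw) = w , Ruw , λ σw′ → contradiction (trans (sym σw) σw′) λ ()

-- Vertex colors V (first level) and N (second level); edge colors C (tree to first level),
-- F (inside the first level) and D (first to second level).
data Kind : Set where
  V N F D : Kind
  C       : Bool → Kind

kindIndex : Kind → Fin 6
kindIndex V         = 0F
kindIndex N         = 1F
kindIndex F         = 2F
kindIndex D         = 3F
kindIndex (C false) = 4F
kindIndex (C true)  = 5F

kind-of : Fin 6 → Kind
kind-of 0F = V
kind-of 1F = N
kind-of 2F = F
kind-of 3F = D
kind-of 4F = C false
kind-of 5F = C true

kind-of∘kindIndex : ∀ k → kind-of (kindIndex k) ≡ k
kind-of∘kindIndex V         = refl
kind-of∘kindIndex N         = refl
kind-of∘kindIndex F         = refl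
kind-of∘kindIndex D         = refl
kind-of∘kindIndex (C false) = refl
kind-of∘kindIndex (C true)  = refl

kindIndex-injective : ∀ {k l} → kindIndex k ≡ kindIndex l → k ≡ l
kindIndex-injective {k} {l} eq = trans (sym (kind-of∘kindIndex k)) (trans (cong kind-of eq) (kind-of∘kindIndex l))

Typed : Set
Typed = Kind × Fin 4

_≟ᵗ_ : (x y : Typed) → Dec (x ≡ y)
_≟ᵗ_ = ≡-dec (λ k l → map′ kindIndex-injective (cong kindIndex) (kindIndex k ≟ kindIndex l)) _≟_

-- The two remaining summands color the vertices and the edges of the tree.
Color : ℕ → Set
Color m = Typed ⊎ (Fin m ⊎ Fin m)

-- The number 24 is six kinds times four types.
encode : ∀ {m} → Color m → Fin (24 + (m + m))
encode {m} (inj₁ (k , t)) = join 24 (m + m) (inj₁ (combine (kindIndex k) t))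
encode {m} (inj₂ c)       = join 24 (m + m) (inj₂ (join m m c))

join-injective : ∀ m n {x y : Fin m ⊎ Fin n} → join m n x ≡ join m n y → x ≡ y
join-injective m n {x} {y} eq = trans (sym (splitAt-join m n x)) (trans (cong (splitAt m) eq) (splitAt-join m n y))

encode-injective : ∀ {m} {c d : Color m} → encode c ≡ encode d → c ≡ d
encode-injective {m} {inj₁ (k , t)} {inj₁ (l , s)} eq
  with combine-injective (kindIndex k) t (kindIndex l) s (inj₁-injective (join-injective 24 (m + m) eq))
... | kl , refl = cong (λ k → inj₁ (k , t)) (kindIndex-injective kl)
encode-injective {m} {inj₁ _} {inj₂ _} eq = contradiction (join-injective 24 (m + m) {inj₁ _} {inj₂ _} eq) λ ()
encode-injective {m} {inj₂ _} {inj₁ _} eq = contradiction (join-injective 24 (m + m) {inj₂ _} {inj₁ _} eq) λ ()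
encode-injective {m} {inj₂ c} {inj₂ d} eq =
  cong inj₂ (join-injective m m (inj₂-injective (join-injective 24 (m + m) {inj₂ (join m m c)} {inj₂ (join m m d)} eq)))

-- The coloring around a tree that is within distance 2 of every vertex

module TwoStepColoring {n : ℕ} (G : Graph n) {L : List (Fin n)} (tree : Adjacency.Tree G L)
  (two-step : ∀ v → Adjacency.Dom G L v ⊎ Adjacency.Second G L v) (2≤deg : ∀ v → 2 ≤ degree G v)
  (τ : Fin n → Fin 4)
  (types : ∀ x → Adjacency.Second G L x → ∀ c → ∃ λ b → adj G x b ≡ true × Adjacency.Dom G L b × τ b ≢ c)
  where

  open Adjacency G

  m : ℕ
  m = length L

  tree-injective : ∀ {L} → Tree L → ∀ {i j} → lookup L i ≡ lookup L j → i ≡ j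
  tree-injective (root v)            {zero}  {zero}  eq = refl
  tree-injective (grow _ _ _ _)      {zero}  {zero}  eq = refl
  tree-injective (grow {L} v∉ _ _ _) {zero}  {suc j} eq = contradiction (subst (_∈ L) (sym eq) (∈-lookup {xs = L} j)) v∉
  tree-injective (grow {L} v∉ _ _ _) {suc i} {zero}  eq = contradiction (subst (_∈ L) eq (∈-lookup {xs = L} i)) v∉
  tree-injective (grow _ _ _ t)      {suc i} {suc j} eq = cong suc (tree-injective t eq)

  -- A vertex is put in front of its parent, so indices increase towards the root, which has the
  -- largest one.
  parent : ∀ {L} → Tree L → ∀ (i : Fin (length L)) → (∃ λ (j : Fin (length L)) → toℕ i < toℕ j × lookup L i ~ lookup L j) ⊎ (∀ (j : Fin (length L)) → toℕ j ≤ toℕ i)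
  parent (root v) zero = inj₂ λ { zero → z≤n }
  parent (grow _ p∈ v~p _) zero =
    inj₁ (suc (index p∈) , s≤s z≤n , subst (_ ~_) (lookup-index p∈) v~p)
  parent (grow _ _ _ t) (suc i) with parent t i
  ... | inj₁ (j , i<j , adj) = inj₁ (suc j , s≤s i<j , adj)
  ... | inj₂ last            = inj₂ λ { zero → z≤n ; (suc j) → s≤s (last j) }

  -- The index of `core` is the vertex's own position in `L`; that of `first` is the position of its
  -- chosen tree neighbour.
  data Level : Set where
    core   : Fin m → Level
    first  : Fin m → Level
    second : Level

  data At (v : Fin n) : Level → Set where
    core   : ∀ {i} → lookup L i ≡ v → At v (core i)
    first  : ∀ {i} → v ∉ L → v ~ lookup L i → At v (first i)
    second : Second L v → At v second

  level : ∀ v → ∃ (At v)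
  level v with _∈?_ _≟_ v L | two-step v
  ... | yes v∈ | _      = core (index v∈) , core (sym (lookup-index v∈))
  ... | no _   | inj₂ s = second , second s
  ... | no v∉  | inj₁ d with s , s∈ , v~s ← Dom-neighbour d v∉ =
    first (index s∈) , first v∉ (subst (v ~_) (lookup-index s∈) v~s)

  lev : Fin n → Level
  lev v = proj₁ (level v)

  core-level : ∀ i → lev (lookup L i) ≡ core i
  core-level i with level (lookup L i)
  ... | _ , core eq        = cong core (tree-injective tree eq)
  ... | _ , first v∉ _     = contradiction (∈-lookup i) v∉
  ... | _ , second (¬d , _) = contradiction (∈⇒Dom (∈-lookup i)) ¬d

  IsFirst : Fin n → Set
  IsFirst v = Dom L v × v ∉ L

  first-level : ∀ {v} → IsFirst v → ∃ λ i → lev v ≡ first i × v ~ lookup L i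
  first-level {v} (d , v∉) with level v
  ... | _ , core {i} refl       = contradiction (∈-lookup i) v∉
  ... | _ , first {i} _ v~i     = i , refl , v~i
  ... | _ , second (¬d , _)     = contradiction d ¬d

  second-level : ∀ {v} → ¬ Dom L v → lev v ≡ second
  second-level {v} ¬d with level v
  ... | _ , core {i} refl       = contradiction (∈⇒Dom (∈-lookup i)) ¬d
  ... | _ , first {i} _ v~i     = contradiction (~∈⇒Dom (∈-lookup i) (~-sym v~i)) ¬d
  ... | _ , second _            = refl

  second-neighbour : ∀ {x b} → ¬ Dom L x → x ~ b → Dom L b → IsFirst b
  second-neighbour ¬dx x~b db = db , λ b∈ → ¬dx (~∈⇒Dom b∈ (~-sym x~b))

  FirstEdge : Fin n → Fin n → Set
  FirstEdge u v = u ~ v × IsFirst u × IsFirst v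

  isFirst? : ∀ v → Dec (IsFirst v)
  isFirst? v = dom? L v ×-dec ¬? (_∈?_ _≟_ v L)

  labelling : ∃ λ (σ : Fin n → Bool) → ∀ {u v} → FirstEdge u v → ∃ λ w → FirstEdge u w × σ w ≢ σ u
  labelling = opposite-labelling FirstEdge (λ u v → (u ~? v) ×-dec (isFirst? u ×-dec isFirst? v))
    (λ { (u~v , fu , fv) → ~-sym u~v , fv , fu }) (λ { {v} (v~v , _) → contradiction (trans (sym v~v) (irrefl G v)) λ () })

  σ : Fin n → Bool
  σ = proj₁ labelling

  main-color : Fin n → Typed
  main-color v = C (σ v) , τ v

  -- A first-level vertex v reserves C (σ v) for the edge to its chosen tree neighbour p.
  link-color : Fin n → Fin m → Fin m → Typed
  link-color v p i = C (if does (i ≟ p) then σ v else not (σ v)) , τ v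

  -- Gives a tree edge the index of its child end, in a form symmetric in both ends; different tree
  -- edges thus get different colors.
  minF : Fin m → Fin m → Fin m
  minF i j with i <? j
  ... | yes _ = i
  ... | no _  = j

  minF-comm : ∀ i j → minF i j ≡ minF j i
  minF-comm i j with i <? j | j <? i
  ... | yes i<j | yes j<i = contradiction j<i (<-asym i<j)
  ... | yes _   | no _    = refl
  ... | no _    | yes _   = refl
  ... | no i≮j  | no j≮i  = toℕ-injective (≤-antisym (≮⇒≥ i≮j) (≮⇒≥ j≮i))

  minF-< : ∀ {i j} → toℕ i < toℕ j → minF i j ≡ i
  minF-< {i} {j} i<j with i <? j
  ... | yes _  = refl
  ... | no i≮j = contradiction i<j i≮j

  vertexColor : Level → Fin n → Color m
  vertexColor (core i)  v = inj₂ (inj₁ i)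
  vertexColor (first _) v = inj₁ (V , τ v)
  vertexColor second    v = inj₁ (N , 0F)

  edgeColor : Level → Level → Fin n → Fin n → Color m
  edgeColor (core i)  (core j)  u v = inj₂ (inj₂ (minF i j))
  edgeColor (core i)  (first p) u v = inj₁ (link-color v p i)
  edgeColor (first p) (core i)  u v = inj₁ (link-color u p i)
  edgeColor (first _) second    u v = inj₁ (D , τ u)
  edgeColor second    (first _) u v = inj₁ (D , τ v)
  edgeColor (first _) (first _) u v = inj₁ (F , 0F)
  -- Default values: no edge joins the tree to the second level, and the routes avoid edges inside
  -- the second level.
  edgeColor (core _)  second    u v = inj₁ (F , 0F)
  edgeColor second    (core _)  u v = inj₁ (F , 0F)
  edgeColor second    second    u v = inj₁ (F , 0F)

  edgeColor-comm : ∀ k l u v → edgeColor k l u v ≡ edgeColor l k v u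
  edgeColor-comm (core i)  (core j)  u v = cong (inj₂ ∘ inj₂) (minF-comm i j)
  edgeColor-comm (core i)  (first p) u v = refl
  edgeColor-comm (first p) (core i)  u v = refl
  edgeColor-comm (first _) second    u v = refl
  edgeColor-comm second    (first _) u v = refl
  edgeColor-comm (first _) (first _) u v = refl
  edgeColor-comm (core _)  second    u v = refl
  edgeColor-comm second    (core _)  u v = refl
  edgeColor-comm second    second    u v = refl

  vc : Fin n → Color m
  vc v = vertexColor (lev v) v

  ec : Fin n → Fin n → Color m
  ec u v = edgeColor (lev u) (lev v) u v

  ec-sym : ∀ u v → ec u v ≡ ec v u
  ec-sym u v = edgeColor-comm (lev u) (lev v) u v

  vc-at : ∀ {v k} → lev v ≡ k → vc v ≡ vertexColor k v
  vc-at refl = refl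

  ec-at : ∀ {u v k l} → lev u ≡ k → lev v ≡ l → ec u v ≡ edgeColor k l u v
  ec-at refl refl = refl

  open RainbowWalks G vc ec ec-sym

  -- Private colors of index at least `k`. The vertex colors of the ends `i` and `j` are left out,
  -- so that either end can become internal in a concatenation.
  TreeColor : ℕ → Fin m → Fin m → Color m → Set
  TreeColor k i j (inj₁ _)        = ⊥
  TreeColor k i j (inj₂ (inj₁ r)) = k ≤ toℕ r × r ≢ i × r ≢ j
  TreeColor k i j (inj₂ (inj₂ r)) = k ≤ toℕ r

  TreeColor-swap : ∀ {k i j} c → TreeColor k i j c → TreeColor k j i c
  TreeColor-swap (inj₂ (inj₁ r)) (k≤ , r≢i , r≢j) = k≤ , r≢j , r≢i
  TreeColor-swap (inj₂ (inj₂ r)) k≤               = k≤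

  -- Induction on g: the walk climbs from the vertex of smaller index to its parent, and all further
  -- colors have larger index.
  tree-walk : ∀ g k → m ≤ g + k → ∀ i j → k ≤ toℕ i → k ≤ toℕ j → Rainbow (TreeColor k i j) (lookup L i) (lookup L j)
  tree-climb : ∀ g k → m ≤ suc g + k → ∀ i j → k ≤ toℕ i → toℕ i < toℕ j → Rainbow (TreeColor k i j) (lookup L i) (lookup L j)

  tree-walk zero    k m≤k i j k≤i k≤j = contradiction (≤-trans m≤k k≤i) (<⇒≱ (toℕ<n i))
  tree-walk (suc g) k m≤ i j k≤i k≤j with <-cmp i j
  ... | tri≈ _ refl _ = stay
  ... | tri< i<j _ _  = tree-climb g k m≤ i j k≤i i<j
  ... | tri> _ _ j<i  = weaken (λ {c} → TreeColor-swap c) (reverse (tree-climb g k m≤ j i k≤j j<i))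

  tree-climb g k m≤ i j k≤i i<j with parent tree i
  -- Only the root has no parent, and no index exceeds that of the root.
  ... | inj₂ last = contradiction i<j (≤⇒≯ (last j))
  ... | inj₁ (p , i<p , i~p) with p ≟ j
  ...   | yes refl = weaken (λ { refl → k≤i }) up
    where
    up : Rainbow (_≡ inj₂ (inj₂ i)) (lookup L i) (lookup L p)
    up = edge i~p (trans (ec-at (core-level i) (core-level p)) (cong (inj₂ ∘ inj₂) (minF-< i<p)))
  ...   | no p≢j = weaken (λ {c} → into c)
    (concatenate up (tree-walk g (suc (toℕ i)) m≤′ p j i<p i<j)
      (λ { refl → <-irrefl refl }) (λ eq → contradiction (trans (sym vc-p) eq) λ ())
      (λ t → proj₁ (proj₂ (subst (TreeColor (suc (toℕ i)) p j) vc-p t)) refl))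
    where
    up : Rainbow (_≡ inj₂ (inj₂ i)) (lookup L i) (lookup L p)
    up = edge i~p (trans (ec-at (core-level i) (core-level p)) (cong (inj₂ ∘ inj₂) (minF-< i<p)))
    vc-p : vc (lookup L p) ≡ inj₂ (inj₁ p)
    vc-p = vc-at (core-level p)
    m≤′ : m ≤ g + suc (toℕ i)
    m≤′ = ≤-trans m≤ (≤-trans (s≤s (+-monoʳ-≤ g k≤i)) (≤-reflexive (sym (+-suc g (toℕ i)))))
    k≤ : ∀ {r : Fin m} → toℕ i < toℕ r → k ≤ toℕ r
    k≤ i<r = ≤-trans k≤i (<⇒≤ i<r)
    into : ∀ c → Via (_≡ inj₂ (inj₂ i)) (lookup L p) (TreeColor (suc (toℕ i)) p j) c → TreeColor k i j c
    into c (inj₁ refl) = k≤i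
    into c (inj₂ (inj₁ eq)) = subst (TreeColor k i j) (sym (trans eq vc-p))
      (k≤ i<p , (λ { refl → <-irrefl refl i<p }) , p≢j)
    into (inj₂ (inj₁ r)) (inj₂ (inj₂ (i<r , _ , r≢j))) = k≤ i<r , (λ { refl → <-irrefl refl i<r }) , r≢j
    into (inj₂ (inj₂ r)) (inj₂ (inj₂ i<r)) = k≤ i<r

  -- Routes to the tree in shared colors

  Ext : (Typed → Set) → Color m → Set
  Ext P (inj₁ x) = P x
  Ext P (inj₂ _) = ⊥

  Route : (Typed → Set) → Fin n → Set
  Route P v = ∃ λ i → Rainbow (Ext P) v (lookup L i)

  -- The routes use shared colors only and the part inside the tree private colors only, so
  -- disjointness of `P` and `Q` is all there is to check. If both routes end at the same tree
  -- vertex, no middle part is inserted.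
  connect : ∀ {P Q u v} → Route P u → Route Q v → (∀ {x} → P x → ¬ Q x) → Rainbow (λ _ → ⊤) u v
  connect {P} {Q} {u} {v} (i , p) (j , q) P#Q = weaken _ (go (i ≟ j))
    where
    ext# : ∀ c → Ext P c → ¬ Ext Q c
    ext# (inj₁ x) Px Qx = P#Q Px Qx
    not-core : ∀ {R : Typed → Set} k → ¬ Ext R (vc (lookup L k))
    not-core {R} k t = subst (Ext R) (vc-at (core-level k)) t
    tree# : ∀ {R : Typed → Set} c → TreeColor 0 i j c → ¬ Ext R c
    tree# (inj₂ _) _ ()
    go : Dec (i ≡ j) → Rainbow (λ _ → ⊤) u v
    go (yes refl) = weaken _ (concatenate p (reverse q) (λ {c} → ext# c) (not-core {P} i) (not-core {Q} i))
    go (no i≢j) = weaken _ (concatenate p (concatenate middle (reverse q) (λ {c} → tree# c) (¬middle j λ (_ , _ , ne) → ne refl) (not-core {Q} j))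
        (λ {c} → disjoint c) (not-core {P} i)
        λ { (inj₁ t) → ¬middle i (λ (_ , ne , _) → ne refl) t
          ; (inj₂ (inj₁ eq)) → i≢j (inj₁-injective (inj₂-injective (trans (sym (vc-at (core-level i))) (trans eq (vc-at (core-level j))))))
          ; (inj₂ (inj₂ t)) → not-core {Q} i t })
      where
      middle : Rainbow (TreeColor 0 i j) (lookup L i) (lookup L j)
      middle = tree-walk m 0 (≤-reflexive (sym (+-identityʳ m))) i j z≤n z≤n
      ¬middle : ∀ r → ¬ TreeColor 0 i j (inj₂ (inj₁ r)) → ¬ TreeColor 0 i j (vc (lookup L r))
      ¬middle r ¬t t = ¬t (subst (TreeColor 0 i j) (vc-at (core-level r)) t)
      disjoint : ∀ c → Ext P c → ¬ Via (TreeColor 0 i j) (lookup L j) (Ext Q) c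
      disjoint c Pc (inj₁ t)           = tree# {P} c t Pc
      disjoint c Pc (inj₂ (inj₁ refl)) = not-core {P} j Pc
      disjoint c Pc (inj₂ (inj₂ Qc))   = ext# c Pc Qc

  link-main : ∀ v p → link-color v p p ≡ main-color v
  link-main v p with p ≟ p
  ... | yes _ = refl
  ... | no ne = contradiction refl ne

  link-other : ∀ v {p i} → i ≢ p → link-color v p i ≢ main-color v
  link-other v {p} {i} i≢p eq with i ≟ p
  ... | yes i≡p = i≢p i≡p
  ... | no _ with σ v
  link-other v i≢p () | no _ | true
  link-other v i≢p () | no _ | false

  main-route : ∀ {v} → IsFirst v → Route (_≡ main-color v) v
  main-route {v} fv with p , eq , v~p ← first-level fv =
    p , weaken (λ { refl → refl }) (edge v~p (trans (ec-at eq (core-level p)) (cong inj₁ (link-main v p))))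

  -- A hop from the second level through `b` uses kinds `D`, `V` and `C`, all of type `τ b`.
  -- Excluding `N` allows its starting vertex to become internal.
  HopColor : Fin n → Typed → Set
  HopColor b (k , t) = k ≢ N × t ≡ τ b

  vc-first : ∀ {v} → IsFirst v → vc v ≡ inj₁ (V , τ v)
  vc-first fv = vc-at (proj₁ (proj₂ (first-level fv)))

  hop : ∀ {x b} → ¬ Dom L x → x ~ b → IsFirst b → Route (HopColor b) x
  hop {x} {b} ¬dx x~b fb with i , r ← main-route fb =
    i , weaken (λ {c} → into c)
      (concatenate (edge x~b (ec-at (second-level ¬dx) (proj₁ (proj₂ (first-level fb))))) r
        (λ { refl () }) (λ eq → contradiction (trans (sym vcb) eq) λ ())
        (λ t → contradiction (subst (Ext (_≡ main-color b)) vcb t) λ ()))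
    where
    vcb = vc-first fb
    into : ∀ c → Via (_≡ inj₁ (D , τ b)) b (Ext (_≡ main-color b)) c → Ext (HopColor b) c
    into c (inj₁ refl)                    = (λ ()) , refl
    into c (inj₂ (inj₁ eq))               = subst (Ext (HopColor b)) (sym (trans eq vcb)) ((λ ()) , refl)
    into (inj₁ _) (inj₂ (inj₂ refl))      = (λ ()) , refl

  other-neighbour : ∀ v s → ∃ λ w → v ~ w × w ≢ s
  other-neighbour v s = pick (filter (v ~?_) (allFin n)) (subst (2 ≤_) (degree≡# v) (2≤deg v))
    (Uniqueₚ.filter⁺ (v ~?_) (Uniqueₚ.allFin⁺ n)) (λ w∈ → proj₂ (∈-filter⁻ (v ~?_) {xs = allFin n} w∈))
    where
    pick : ∀ xs → 2 ≤ length xs → Unique xs → (∀ {w} → w ∈ xs → v ~ w) → ∃ λ w → v ~ w × w ≢ s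
    pick (x ∷ y ∷ _) _ ((x≢y ∷ _) ∷ _) nb with x ≟ s
    ... | no x≢s   = x , nb (here refl) , x≢s
    ... | yes refl = y , nb (there (here refl)) , x≢y ∘ sym
    pick (_ ∷ []) (s≤s ()) _ _

  -- The route starts with a neighbour `w` other than the chosen tree vertex. If `w` is in the tree,
  -- its link carries the opposite label.
  alternative-route : ∀ {v} → IsFirst v → Route (_≢ main-color v) v
  alternative-route {v} fv with p , lev-v , v~p ← first-level fv
    with w , v~w , w≢p ← other-neighbour v (lookup L p) with level w
  ... | _ , core {i} refl = i , weaken (λ { refl → link-other v {p} {i} (λ { refl → w≢p refl }) })
                                  (edge v~w (ec-at lev-v (core-level i)))
  -- `w` may carry the label of `v`, but it shows that `v` has a first-level neighbour, so
  -- `labelling` supplies one, `u`, with the other label.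
  ... | _ , first {q} w∉ w~q
    with u , (v~u , _ , fu) , σu≢σv ← proj₂ labelling (v~w , fv , ~∈⇒Dom (∈-lookup q) (~-sym w~q) , w∉)
    with i , r ← main-route fu =
    i , weaken (λ {c} → into c) (concatenate (edge v~u (ec-at lev-v (proj₁ (proj₂ (first-level fu))))) r
      (λ { refl () }) (λ eq → contradiction (trans (sym vcu) eq) λ ())
      (λ t → contradiction (subst (Ext (_≡ main-color u)) vcu t) λ ()))
    where
    vcu = vc-first fu
    into : ∀ c → Via (_≡ inj₁ (F , 0F)) u (Ext (_≡ main-color u)) c → Ext (_≢ main-color v) c
    into c (inj₁ refl)               = λ ()
    into c (inj₂ (inj₁ eq))          = subst (Ext (_≢ main-color v)) (sym (trans eq vcu)) λ ()
    into (inj₁ _) (inj₂ (inj₂ refl)) = λ eq → σu≢σv (C-injective (cong proj₁ eq))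
      where
      C-injective : ∀ {a b} → C a ≡ C b → a ≡ b
      C-injective refl = refl
  -- The hop leaves `w` through some `b` of a type other than `τ v`. This avoids both the main color
  -- of `v` and the color `(D , τ v)` of the first edge.
  ... | _ , second sw@(¬dw , _)
    with b , w~b , db , τb≢τv ← types w sw (τ v)
    with i , r ← hop ¬dw w~b (second-neighbour ¬dw w~b db) =
    i , weaken (λ {c} → into c) (concatenate (edge v~w (ec-at lev-v (second-level ¬dw))) r
      (λ { refl (_ , eq) → τb≢τv (sym eq) }) (λ eq → contradiction (trans (sym vcw) eq) λ ())
      (λ t → proj₁ (subst (Ext (HopColor b)) vcw t) refl))
    where
    vcw : vc w ≡ inj₁ (N , 0F)
    vcw = vc-at (second-level ¬dw)
    into : ∀ c → Via (_≡ inj₁ (D , τ v)) w (Ext (HopColor b)) c → Ext (_≢ main-color v) c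
    into c (inj₁ refl)                    = λ ()
    into c (inj₂ (inj₁ eq))               = subst (Ext (_≢ main-color v)) (sym (trans eq vcw)) λ ()
    into (inj₁ _) (inj₂ (inj₂ (_ , t≡)))  = λ eq → τb≢τv (trans (sym t≡) (cong proj₂ eq))

  TypedRoute : Fin n → Fin 4 → Set
  TypedRoute v t = Route (λ x → proj₂ x ≡ t) v

  -- The ability to reach the tree within one type while avoiding any type named in advance; tree
  -- vertices and second-level vertices have it.
  Flexible : Fin n → Set
  Flexible v = ∀ t → ∃ λ s → s ≢ t × TypedRoute v s

  route-or-first : ∀ v → Flexible v ⊎ IsFirst v
  route-or-first v with level v
  -- The empty route has every type vacuously.
  ... | _ , core {i} refl = inj₁ λ t → let s , s≢t = other t in s , s≢t , i , stay
    where
    other : ∀ (t : Fin 4) → ∃ λ s → s ≢ t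
    other 0F      = 1F , λ ()
    other (suc _) = 0F , λ ()
  ... | _ , first {i} v∉ v~i = inj₂ (~∈⇒Dom (∈-lookup i) (~-sym v~i) , v∉)
  ... | _ , second sv@(¬dv , _) = inj₁ λ t →
    let b , v~b , db , τb≢t = types v sv t
        i , r = hop ¬dv v~b (second-neighbour ¬dv v~b db)
    in τ b , τb≢t , i , weaken (λ { {inj₁ _} (_ , eq) → eq }) r

  some-type : ∀ v → ∃ (TypedRoute v)
  some-type v with route-or-first v
  ... | inj₁ flex = let s , _ , r = flex 0F in s , r
  ... | inj₂ fv   = let i , r = main-route fv in τ v , i , weaken (λ { {inj₁ _} refl → refl }) r

  connect-flexible : ∀ u {v} → Flexible v → Rainbow (λ _ → ⊤) u v
  connect-flexible u flex with t , r ← some-type u with s , s≢t , q ← flex t =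
    connect r q λ { refl eq → s≢t (sym eq) }

  -- A flexible end adapts to the type used by the other one. Between two first-level vertices, each
  -- main route consists of one edge; if their colors coincide, one vertex takes its alternative
  -- route.
  rainbow-connected : ∀ u v → Rainbow (λ _ → ⊤) u v
  rainbow-connected u v with route-or-first u | route-or-first v
  ... | _         | inj₁ flex = connect-flexible u flex
  ... | inj₁ flex | inj₂ _    = reverse (connect-flexible v flex)
  ... | inj₂ fu   | inj₂ fv with main-color u ≟ᵗ main-color v
  ...   | yes eq = connect (alternative-route fu) (main-route fv) λ { ne refl → ne (sym eq) }
  ...   | no ne  = connect (main-route fu) (main-route fv) λ { refl eq → ne eq }

  trc-colorable : TRCColorable G (24 + (m + m))
  trc-colorable = colorable G vc ec ec-sym encode encode-injective λ u v → _ , rainbow-connected u v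

-- Arithmetic

-- The bound on the quotient in `BoundIII`: of the 24 shared colors 4 are subtracted, and the
-- remaining 20 are divided by 4.
five : ℚ
five = (ℤ.+ 5) ℚ./ 1

/-≤-five : ∀ i d → i ℤ.≤ (ℤ.+ 5) ℤ.* (ℤ.+ suc d) → i ℚ./ suc d ℚ.≤ five
/-≤-five i d i≤ = ℚ.toℚᵘ-cancel-≤ (ℚᵘ.≤-respˡ-≃ (ℚᵘ.≃-sym (ℚ.toℚᵘ-fromℚᵘ (ℚᵘ.mkℚᵘ i d)))
  (ℚᵘ.*≤* (subst (ℤ._≤ (ℤ.+ 5) ℤ.* (ℤ.+ suc d)) (sym (ℤ.*-identityʳ i)) i≤)))

powℚ-nonNeg : ∀ q k → 0ℚ ℚ.≤ q → 0ℚ ℚ.≤ powℚ q k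
powℚ-nonNeg q zero    _   = toWitness {a? = 0ℚ ℚ.≤? 1ℚ} tt
powℚ-nonNeg q (suc k) 0≤q = subst (ℚ._≤ powℚ q k ℚ.* q) (ℚ.*-zeroʳ (powℚ q k))
  (ℚ.*-monoˡ-≤-nonNeg (powℚ q k) {{ℚ.nonNegative (powℚ-nonNeg q k 0≤q)}} 0≤q)

powℚ-mono : ∀ {p q} k → 0ℚ ℚ.≤ p → p ℚ.≤ q → powℚ p k ℚ.≤ powℚ q k
powℚ-mono zero _ _ = ℚ.≤-refl
powℚ-mono {p} {q} (suc k) 0≤p p≤q = ℚ.≤-trans
  (ℚ.*-monoˡ-≤-nonNeg (powℚ p k) {{ℚ.nonNegative (powℚ-nonNeg p k 0≤p)}} p≤q)
  (ℚ.*-monoʳ-≤-nonNeg q {{ℚ.nonNegative (ℚ.≤-trans 0≤p p≤q)}} (powℚ-mono k 0≤p p≤q))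

-- Already the first term of the exponential series suffices.
≤⇒LeScaledExp : ∀ {r c} x → r ℚ.≤ c → LeScaledExp r c x
≤⇒LeScaledExp {r} {c} x r≤c ε ε>0 = 1 , ℚ.≤-trans r≤c
  (subst₂ (λ d e → d ℚ.≤ e ℚ.+ ε) (ℚ.+-identityʳ c) (sym (ℚ.*-identityʳ c))
    (ℚ.+-monoʳ-≤ c (ℚ.nonNegative⁻¹ ε {{ℚ.pos⇒nonNeg ε {{ε>0}}}})))

-- For positive `q`, monotonicity of powers replaces `q` by 5, leaving an inequality between
-- explicit rationals for each δ.
power-bound : ∀ q k c x → q ℚ.≤ five → powℚ five k ℚ.≤ c → (q ℚ.≤ 0ℚ) ⊎ LeScaledExp (powℚ q k) c x
power-bound q k c x q≤5 5ᵏ≤c with q ℚ.≤? 0ℚ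
... | yes q≤0 = inj₁ q≤0
... | no q≰0  = inj₂ (≤⇒LeScaledExp x (ℚ.≤-trans (powℚ-mono k (ℚ.<⇒≤ (ℚ.≰⇒> q≰0)) q≤5) 5ᵏ≤c))

numerator-bound : ∀ n d t → t * d ≤ 6 * n + 24 * d →
  ((ℤ.+ t) ℤ.- (ℤ.+ 4)) ℤ.* (ℤ.+ d) ℤ.- (ℤ.+ (7 * n)) ℤ.≤ (ℤ.+ 5) ℤ.* (ℤ.+ (4 * d))
numerator-bound n d t h = begin
  ((ℤ.+ t) ℤ.- (ℤ.+ 4)) ℤ.* (ℤ.+ d) ℤ.- (ℤ.+ (7 * n))
    ≡⟨ expand (ℤ.+ t) (ℤ.+ d) (ℤ.+ (7 * n)) ⟩
  (ℤ.+ t) ℤ.* (ℤ.+ d) ℤ.- ((ℤ.+ 4) ℤ.* (ℤ.+ d) ℤ.+ (ℤ.+ (7 * n)))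
    ≡⟨ cong (ℤ._- ((ℤ.+ 4) ℤ.* (ℤ.+ d) ℤ.+ (ℤ.+ (7 * n)))) (sym (ℤ.pos-* t d)) ⟩
  ℤ.+ (t * d) ℤ.- ((ℤ.+ 4) ℤ.* (ℤ.+ d) ℤ.+ (ℤ.+ (7 * n)))
    ≤⟨ ℤ.+-monoˡ-≤ (ℤ.- ((ℤ.+ 4) ℤ.* (ℤ.+ d) ℤ.+ (ℤ.+ (7 * n)))) (ℤ.+≤+ (≤-trans h (+-monoˡ-≤ (24 * d) (*-monoˡ-≤ n (n≤1+n 6))))) ⟩
  ℤ.+ (7 * n + 24 * d) ℤ.- ((ℤ.+ 4) ℤ.* (ℤ.+ d) ℤ.+ (ℤ.+ (7 * n)))
    ≡⟨ cong (λ z → (ℤ.+ (7 * n)) ℤ.+ z ℤ.- ((ℤ.+ 4) ℤ.* (ℤ.+ d) ℤ.+ (ℤ.+ (7 * n)))) (ℤ.pos-* 24 d) ⟩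
  (ℤ.+ (7 * n)) ℤ.+ (ℤ.+ 24) ℤ.* (ℤ.+ d) ℤ.- ((ℤ.+ 4) ℤ.* (ℤ.+ d) ℤ.+ (ℤ.+ (7 * n)))
    ≡⟨ collect (ℤ.+ d) (ℤ.+ (7 * n)) ⟩
  (ℤ.+ 5) ℤ.* ((ℤ.+ 4) ℤ.* (ℤ.+ d))
    ≡⟨ cong ((ℤ.+ 5) ℤ.*_) (sym (ℤ.pos-* 4 d)) ⟩
  (ℤ.+ 5) ℤ.* (ℤ.+ (4 * d)) ∎
  where
  open ℤ.≤-Reasoning
  expand : ∀ t d s → (t ℤ.- (ℤ.+ 4)) ℤ.* d ℤ.- s ≡ t ℤ.* d ℤ.- ((ℤ.+ 4) ℤ.* d ℤ.+ s)
  expand = ℤRing.solve-∀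
  collect : ∀ d s → s ℤ.+ (ℤ.+ 24) ℤ.* d ℤ.- ((ℤ.+ 4) ℤ.* d ℤ.+ s) ≡ (ℤ.+ 5) ℤ.* ((ℤ.+ 4) ℤ.* d)
  collect = ℤRing.solve-∀

boundIII : ∀ n δ t → 6 ≤ δ → δ ≤ 15 → t * suc δ ≤ 6 * n + 24 * suc δ → BoundIII n δ t
boundIII n δ t 6≤δ δ≤15 h = power-bound _ (δ ∸ 3) _ _
  -- `δ + 3 * suc δ` is the predecessor of the denominator `4 * suc δ`.
  (/-≤-five (((ℤ.+ t) ℤ.- (ℤ.+ 4)) ℤ.* (ℤ.+ suc δ) ℤ.- (ℤ.+ (7 * n))) (δ + 3 * suc δ) (numerator-bound n (suc δ) t h)) (table δ 6≤δ δ≤15)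
  where
  Claim : ℕ → Set
  Claim δ = powℚ five (δ ∸ 3) ℚ.≤ powℚ ((ℤ.+ Aδ δ) ℚ./ 3) 3
  -- Ten numerical inequalities, decided by evaluation.
  table : ∀ δ → 6 ≤ δ → δ ≤ 15 → Claim δ
  table 6  _ _ = toWitness {a? = _ ℚ.≤? _} tt
  table 7  _ _ = toWitness {a? = _ ℚ.≤? _} tt
  table 8  _ _ = toWitness {a? = _ ℚ.≤? _} tt
  table 9  _ _ = toWitness {a? = _ ℚ.≤? _} tt
  table 10 _ _ = toWitness {a? = _ ℚ.≤? _} tt
  table 11 _ _ = toWitness {a? = _ ℚ.≤? _} tt
  table 12 _ _ = toWitness {a? = _ ℚ.≤? _} tt
  table 13 _ _ = toWitness {a? = _ ℚ.≤? _} tt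
  table 14 _ _ = toWitness {a? = _ ℚ.≤? _} tt
  table 15 _ _ = toWitness {a? = _ ℚ.≤? _} tt
  table (suc (suc (suc (suc (suc (suc (suc (suc (suc (suc (suc (suc (suc (suc (suc (suc δ)))))))))))))))) _ le =
    ⊥-elim (<⇒≱ (m≤m+n 16 δ) le)
  table 0 () _
  table 1 (s≤s ()) _
  table 2 (s≤s (s≤s ())) _
  table 3 (s≤s (s≤s (s≤s ()))) _
  table 4 (s≤s (s≤s (s≤s (s≤s ())))) _
  table 5 (s≤s (s≤s (s≤s (s≤s (s≤s ()))))) _

-- From the tree to the three bounds

trc-bound : ∀ {n} (G : Graph n) {δ t} → 2 ≤ δ → Connected G → IsMinDegree G δ → IsTRC G t →
            t * suc δ ≤ 6 * n + 24 * suc δ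
trc-bound {n} G {δ} {t} 2≤δ connected (δ≤deg , v , _) (_ , minimal) = begin
  -- By minimality `t` is at most the 24 + 2 |L| colors of the construction, and the growth
  -- invariant bounds |L| (δ + 1) by 3 n.
  t * suc δ                          ≤⟨ *-monoˡ-≤ (suc δ) (minimal _ colorable-24) ⟩
  (24 + (m + m)) * suc δ             ≡⟨ regroup m (suc δ) ⟩
  2 * (m * suc δ) + 24 * suc δ       ≤⟨ +-monoˡ-≤ (24 * suc δ) (*-monoʳ-≤ 2 size) ⟩
  2 * (3 * n) + 24 * suc δ           ≡⟨ cong (_+ 24 * suc δ) (*-assoc 2 3 n) ⟨
  6 * n + 24 * suc δ                 ∎
  where
  open ≤-Reasoning
  open Growth G δ connected δ≤deg
  skeleton = saturated-tree v
  L = proj₁ skeleton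
  m = length L
  size = proj₁ (proj₂ (proj₂ skeleton))
  saturated = proj₂ (proj₂ (proj₂ skeleton))
  types = second-types saturated
  colorable-24 : TRCColorable G (24 + (m + m))
  colorable-24 = TwoStepColoring.trc-colorable G (proj₁ (proj₂ skeleton)) (Saturated.two-step saturated)
    (λ u → ≤-trans 2≤δ (δ≤deg u)) (proj₁ types) (proj₂ types)
  regroup : ∀ m d → (24 + (m + m)) * d ≡ 2 * (m * d) + 24 * d
  regroup = solve-∀

theorem5 : ∀ (n : ℕ) (G : Graph n) (δ t : ℕ)
    → Connected G → IsMinDegree G δ → IsTRC G t
    → ((n ∸ 2 ≤ suc δ * suc δ) → 291 ≤ n → t * suc δ ≤ 6 * n + 28 * suc δ)
    × ((16 ≤ δ) → ((δ + 2) * (δ + 2) + 2 ≤ n) → t * suc δ ≤ 7 * n + 32 * suc δ)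
    × ((6 ≤ δ) → (δ ≤ 15) → BoundIII n δ t)
theorem5 n G δ t connected minDegree trc =
    (λ n≤ 291≤n → ≤-trans (bound (2≤ δ (≤-trans (∸-monoˡ-≤ 2 291≤n) n≤)))
                    (+-monoʳ-≤ (6 * n) (*-monoˡ-≤ (suc δ) (m≤m+n 24 4))))
  , (λ 16≤δ _ → ≤-trans (bound (≤-trans (m≤m+n 2 14) 16≤δ))
                  (+-mono-≤ (*-monoˡ-≤ n (m≤m+n 6 1)) (*-monoˡ-≤ (suc δ) (m≤m+n 24 8))))
  , (λ 6≤δ δ≤15 → boundIII n δ t 6≤δ δ≤15 (bound (≤-trans (m≤m+n 2 4) 6≤δ)))
  where
  bound : 2 ≤ δ → t * suc δ ≤ 6 * n + 24 * suc δ
  bound 2≤δ = trc-bound G 2≤δ connected minDegree trc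
  -- 289 is 291 - 2; for δ at most 1 the square is at most 4.
  2≤ : ∀ δ → 289 ≤ suc δ * suc δ → 2 ≤ δ
  2≤ zero          (s≤s ())
  2≤ (suc zero)    (s≤s (s≤s (s≤s (s≤s ()))))
  2≤ (suc (suc δ)) _ = s≤s (s≤s z≤n)
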